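{- Let $k\geq 2$ be an integer. There exists a planar signed bipartite graph $[G,\Sigma]$ of unbalanced-girth $2k$ such that in $[G,\Sigma]^{(2k-2)}$ each part of the bipartition of $G$ induces a graph containing a clique of size at least $2^{2k-2}$.
   Context: A signature on a graph $G$ is a set $\Sigma\subseteq E(G)$ of edges declared negative. Re-signing at a vertex set $X$ changes the sign of every edge with exactly one end in $X$; two signatures are equivalent if one is obtained from the other by re-signing, and a signed graph $[G,\Sigma]$ is $G$ together with the class of signatures equivalent to $\Sigma$. A signed bipartite graph is a signed graph whose underlying graph is bipartite. A cycle is unbalanced if it has an odd number of negative edges; the unbalanced-girth is the length of a shortest unbalanced cycle. For a signed bipartite graph $[G,\Sigma]$ with bipartition $(X,Y)$ and an even integer $r\geq 2$, $[G,\Sigma]^{(r)}$ is the (unsigned) graph on $V(G)$ in which two distinct vertices $u,v$ are adjacent if and only if (i) $u$ and $v$ lie in the same part, and (ii) there are $u,v$-paths $P_1,P_2$ in $G$, each of length at most $r$, such that $P_1$ has an odd number of negative edges and $P_2$ has an even number of negative edges. -}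

module Defs where

open import Algebra.Properties.CommutativeSemigroup using (interchange)
open import Data.Bool.Base using (Bool; true; false; T; _xor_; if_then_else_)
open import Data.Fin.Base using (Fin)
open import Data.List.Base as List using (List; []; _∷_; _∷ʳ_)
open import Data.List.Properties using (unfold-reverse)
open import Data.List.Relation.Binary.Permutation.Propositional using (↭⇒↭ₛ; ↭-sym)
open import Data.List.Relation.Binary.Permutation.Propositional.Properties using (↭-reverse)
open import Data.List.Relation.Unary.Unique.Propositional using (Unique)
import Data.List.Relation.Binary.Permutation.Setoid.Properties as Permutationₛ
open import Data.Nat.Base as ℕ using (ℕ; zero; suc; parity)
import Data.Nat.Properties as ℕ
open import Data.Parity.Base as ℙ using (Parity; 0ℙ; 1ℙ)
import Data.Parity.Properties as ℙ
open import Data.Product.Base using (Σ; Σ-syntax; ∃; ∃-syntax; _×_; _,_; proj₁; proj₂)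
open import Data.Rational.Base as ℚ using (ℚ; 0ℚ; 1ℚ)
open import Data.Sum.Base using (_⊎_)
open import Data.Unit.Base using (⊤)
open import Function.Base using (_∘_)
open import Function.Bundles using (_↔_; _⇔_; mk⇔)
open import Function.Definitions using (Injective)
open import Relation.Binary.Definitions using (Decidable; Symmetric)
open import Relation.Binary.PropositionalEquality
open import Relation.Nullary.Negation.Core using (¬_)

------------------------------------------------------------------------
-- Simple graphs

record Graph (V : Set) : Set₁ where
  infix 4 _—_
  field
    _—_    : V → V → Set
    —-sym  : Symmetric _—_
    —-irr  : ∀ {v} → ¬ (v — v)

record IsFinite {V : Set} (G : Graph V) : Set where
  open Graph G
  field
    order : ℕ
    enum  : V ↔ Fin order
    _—?_  : Decidable _—_

induced : {V : Set} → Graph V → (P : V → Set) → Graph (Σ V P)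
induced G P = record
  { _—_   = λ u v → proj₁ u — proj₁ v
  ; —-sym = —-sym
  ; —-irr = —-irr
  } where open Graph G

-- The map is automatically injective, adjacency being irreflexive.
IsClique : {V : Set} (G : Graph V) {m : ℕ} → (Fin m → V) → Set
IsClique G c = ∀ {i j} → i ≢ j → Graph._—_ G (c i) (c j)

HasCliqueOfSizeAtLeast : ℕ → {V : Set} → Graph V → Set
HasCliqueOfSizeAtLeast n {V} G =
  ∃[ m ] n ℕ.≤ m × Σ[ c ∈ (Fin m → V) ] IsClique G c

------------------------------------------------------------------------
-- Walks, paths and cycles

module _ {V : Set} (G : Graph V) where
  open Graph G

  infixr 5 _∷_

  data Walk : V → V → Set where
    []  : ∀ {v} → Walk v v
    _∷_ : ∀ {u v w} → u — v → Walk v w → Walk u w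

module _ {V : Set} {G : Graph V} where
  open Graph G

  length : ∀ {u v} → Walk G u v → ℕ
  length []      = 0
  length (_ ∷ w) = suc (length w)

  vertices : ∀ {u v} → Walk G u v → List V
  vertices {u} []      = u ∷ []
  vertices {u} (_ ∷ w) = u ∷ vertices w

  IsPath : ∀ {u v} → Walk G u v → Set
  IsPath w = Unique (vertices w)

record Cycle {V : Set} (G : Graph V) : Set where
  open Graph G
  field
    {base next} : V
    first       : base — next
    rest        : Walk G next base
    rest-path   : IsPath rest
    -- excludes the closed walk that goes back and forth along one edge
    rest-long   : 2 ℕ.≤ length rest

  walk : Walk G base base
  walk = first ∷ rest

------------------------------------------------------------------------
-- Signed graphs

record Signature {V : Set} (G : Graph V) : Set where
  open Graph G
  field
    negative     : V → V → Bool
    negative-sym : ∀ u v → negative u v ≡ negative v u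
    negative⊆E   : ∀ {u v} → T (negative u v) → u — v

bit : Bool → ℕ
bit b = if b then 1 else 0

module _ {V : Set} {G : Graph V} where
  open Graph G
  open Signature

  -- X u xor X v holds exactly when the edge uv has one end in X.
  _≈[_]_ : Signature G → (V → Bool) → Signature G → Set
  Σ₁ ≈[ X ] Σ₂ =
    ∀ {u v} → u — v → negative Σ₂ u v ≡ negative Σ₁ u v xor (X u xor X v)

  _≈_ : Signature G → Signature G → Set
  Σ₁ ≈ Σ₂ = ∃[ X ] Σ₁ ≈[ X ] Σ₂

  negatives : Signature G → ∀ {u v} → Walk G u v → ℕ
  negatives S []                = 0
  negatives S (_∷_ {u} {v} _ w) = bit (negative S u v) ℕ.+ negatives S w

  walkParity : Signature G → ∀ {u v} → Walk G u v → Parity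
  walkParity S w = parity (negatives S w)

  Unbalanced : Signature G → Cycle G → Set
  Unbalanced S C = walkParity S (Cycle.walk C) ≡ 1ℙ

  HasUnbalancedGirth : Signature G → ℕ → Set
  HasUnbalancedGirth S g =
    (∃[ C ] Unbalanced S C × length (Cycle.walk C) ≡ g) ×
    (∀ C → Unbalanced S C → g ℕ.≤ length (Cycle.walk C))

-- The signed graph [G,Σ] is given by a representative Σ of its class;
-- unbalanced-resp-≈ and signedPower-resp-≈ below show that the choice of
-- representative is immaterial.
record SignedBipartiteGraph : Set₁ where
  field
    V         : Set
    graph     : Graph V
    finite    : IsFinite graph
    signature : Signature graph
    part      : V → Bool
  open Graph graph public
  field
    bipartite : ∀ {u v} → u — v → part u ≢ part v

------------------------------------------------------------------------
-- Reversing walks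

module _ {V : Set} {G : Graph V} where
  open Graph G

  snoc : ∀ {u v w} → Walk G u v → v — w → Walk G u w
  snoc []      e = e ∷ []
  snoc (f ∷ w) e = f ∷ snoc w e

  reverse : ∀ {u v} → Walk G u v → Walk G v u
  reverse []      = []
  reverse (e ∷ w) = snoc (reverse w) (—-sym e)

  length-snoc : ∀ {u v w} (p : Walk G u v) (e : v — w) →
                length (snoc p e) ≡ suc (length p)
  length-snoc []      e = refl
  length-snoc (_ ∷ p) e = cong suc (length-snoc p e)

  length-reverse : ∀ {u v} (p : Walk G u v) → length (reverse p) ≡ length p
  length-reverse []      = refl
  length-reverse (e ∷ p) =
    trans (length-snoc (reverse p) _) (cong suc (length-reverse p))

  vertices-snoc : ∀ {u v w} (p : Walk G u v) (e : v — w) →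
                  vertices (snoc p e) ≡ vertices p ∷ʳ w
  vertices-snoc []      e = refl
  vertices-snoc (_ ∷ p) e = cong (_ ∷_) (vertices-snoc p e)

  vertices-reverse : ∀ {u v} (p : Walk G u v) →
                     vertices (reverse p) ≡ List.reverse (vertices p)
  vertices-reverse []      = refl
  vertices-reverse {u} (e ∷ p) = begin
    vertices (snoc (reverse p) _)     ≡⟨ vertices-snoc (reverse p) _ ⟩
    vertices (reverse p) ∷ʳ u         ≡⟨ cong (_∷ʳ u) (vertices-reverse p) ⟩
    List.reverse (vertices p) ∷ʳ u    ≡⟨ unfold-reverse u (vertices p) ⟨
    List.reverse (u ∷ vertices p)     ∎
    where open ≡-Reasoning

  reverse-isPath : ∀ {u v} {p : Walk G u v} → IsPath p → IsPath (reverse p)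
  reverse-isPath {p = p} uniq = subst Unique (sym (vertices-reverse p))
    (Permutationₛ.Unique-resp-↭ (setoid V)
      (↭⇒↭ₛ (↭-sym (↭-reverse (vertices p)))) uniq)

  module _ (S : Signature G) where
    open Signature S

    negatives-snoc : ∀ {u v w} (p : Walk G u v) (e : v — w) →
                     negatives S (snoc p e) ≡
                     bit (negative v w) ℕ.+ negatives S p
    negatives-snoc []      e = refl
    negatives-snoc {v = v} {w} (_∷_ {a} {b} _ p) e = begin
      bit (negative a b) ℕ.+ negatives S (snoc p e)
        ≡⟨ cong (bit (negative a b) ℕ.+_) (negatives-snoc p e) ⟩
      bit (negative a b) ℕ.+ (bit (negative v w) ℕ.+ negatives S p)
        ≡⟨ ℕ.+-assoc (bit (negative a b)) _ _ ⟨
      (bit (negative a b) ℕ.+ bit (negative v w)) ℕ.+ negatives S p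
        ≡⟨ cong (ℕ._+ negatives S p) (ℕ.+-comm (bit (negative a b)) _) ⟩
      (bit (negative v w) ℕ.+ bit (negative a b)) ℕ.+ negatives S p
        ≡⟨ ℕ.+-assoc (bit (negative v w)) _ _ ⟩
      bit (negative v w) ℕ.+ (bit (negative a b) ℕ.+ negatives S p) ∎
      where open ≡-Reasoning

    negatives-reverse : ∀ {u v} (p : Walk G u v) →
                        negatives S (reverse p) ≡ negatives S p
    negatives-reverse []      = refl
    negatives-reverse (_∷_ {a} {b} e p) =
      trans (negatives-snoc (reverse p) _)
            (cong₂ (λ x y → bit x ℕ.+ y)
                   (negative-sym b a) (negatives-reverse p))

------------------------------------------------------------------------
-- The graph [G,Σ]⁽ʳ⁾

module _ {V : Set} {G : Graph V} where

  HasShortPath : Signature G → ℕ → Parity → V → V → Set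
  HasShortPath S r π u v =
    Σ[ P ∈ Walk G u v ] IsPath P × length P ℕ.≤ r × walkParity S P ≡ π

  HasShortPath-sym : ∀ S r π {u v} →
                     HasShortPath S r π u v → HasShortPath S r π v u
  HasShortPath-sym S r π (P , isP , P≤r , P≡π) =
    reverse P ,
    reverse-isPath isP ,
    subst (ℕ._≤ r) (sym (length-reverse P)) P≤r ,
    trans (cong parity (negatives-reverse S P)) P≡π

signedPower : (B : SignedBipartiteGraph) → ℕ → Graph (SignedBipartiteGraph.V B)
signedPower B r = record
  { _—_   = λ u v → u ≢ v × part u ≡ part v ×
                    HasShortPath signature r 1ℙ u v ×
                    HasShortPath signature r 0ℙ u v
  ; —-sym = λ (u≢v , same , P₁ , P₂) →
              u≢v ∘ sym , sym same ,
              HasShortPath-sym signature r 1ℙ P₁ ,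
              HasShortPath-sym signature r 0ℙ P₂
  ; —-irr = λ (v≢v , _) → v≢v refl
  } where open SignedBipartiteGraph B

------------------------------------------------------------------------
-- Independence of the representative signature

module _ {V : Set} {G : Graph V} where
  open Graph G
  open Signature

  private
    pbit : Bool → Parity
    pbit b = parity (bit b)

    pbit-xor : ∀ a b → pbit (a xor b) ≡ pbit a ℙ.+ pbit b
    pbit-xor false b     = refl
    pbit-xor true  false = refl
    pbit-xor true  true  = refl

    telescope : ∀ a b c → (a ℙ.+ b) ℙ.+ (b ℙ.+ c) ≡ a ℙ.+ c
    telescope a 0ℙ c  = cong (ℙ._+ c) (ℙ.+-identityʳ a)
    telescope 0ℙ 1ℙ 0ℙ = refl
    telescope 0ℙ 1ℙ 1ℙ = refl
    telescope 1ℙ 1ℙ 0ℙ = refl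
    telescope 1ℙ 1ℙ 1ℙ = refl

    cancel : ∀ a → a ℙ.+ a ≡ 0ℙ
    cancel 0ℙ = refl
    cancel 1ℙ = refl

  walkParity-resign :
    ∀ S₁ S₂ X → S₁ ≈[ X ] S₂ → ∀ {u v} (w : Walk G u v) →
    walkParity S₂ w ≡ walkParity S₁ w ℙ.+ (pbit (X u) ℙ.+ pbit (X v))
  walkParity-resign S₁ S₂ X _ {u} [] = sym (cancel (pbit (X u)))
  walkParity-resign S₁ S₂ X resign {v = z} (_∷_ {u} {v} e w) = begin
    parity (bit n₂ ℕ.+ negatives S₂ w)
      ≡⟨ ℙ.+-homo-+ (bit n₂) _ ⟩
    pbit n₂ ℙ.+ walkParity S₂ w
      ≡⟨ cong₂ ℙ._+_ n₂≡ (walkParity-resign S₁ S₂ X resign w) ⟩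
    (pbit n₁ ℙ.+ (x u ℙ.+ x v)) ℙ.+ (walkParity S₁ w ℙ.+ (x v ℙ.+ x z))
      ≡⟨ interchange ℙ.+-commutativeSemigroup (pbit n₁) _ _ _ ⟩
    (pbit n₁ ℙ.+ walkParity S₁ w) ℙ.+ ((x u ℙ.+ x v) ℙ.+ (x v ℙ.+ x z))
      ≡⟨ cong₂ ℙ._+_ (sym (ℙ.+-homo-+ (bit n₁) _)) (telescope (x u) (x v) (x z)) ⟩
    parity (bit n₁ ℕ.+ negatives S₁ w) ℙ.+ (x u ℙ.+ x z) ∎
    where
    open ≡-Reasoning
    n₁ = negative S₁ u v
    n₂ = negative S₂ u v
    x : V → Parity
    x a = pbit (X a)
    n₂≡ : pbit n₂ ≡ pbit n₁ ℙ.+ (x u ℙ.+ x v)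
    n₂≡ = trans (cong pbit (resign e))
         (trans (pbit-xor n₁ (X u xor X v)) (cong (pbit n₁ ℙ.+_) (pbit-xor (X u) (X v))))

  ≈-sym : ∀ (S₁ S₂ : Signature G) → S₁ ≈ S₂ → S₂ ≈ S₁
  ≈-sym S₁ S₂ (X , resign) = X , λ {u} {v} e →
    xor-flip (negative S₁ u v) (X u xor X v) (resign e)
    where
    xor-flip : ∀ a b {c} → c ≡ a xor b → a ≡ c xor b
    xor-flip false false refl = refl
    xor-flip false true  refl = refl
    xor-flip true  false refl = refl
    xor-flip true  true  refl = refl

  unbalanced-resp-≈ : ∀ (S₁ S₂ : Signature G) → S₁ ≈ S₂ → ∀ C → Unbalanced S₁ C ⇔ Unbalanced S₂ C
  unbalanced-resp-≈ S₁ S₂ (X , resign) C = mk⇔ (trans same) (trans (sym same))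
    where
    open Cycle C
    same : walkParity S₂ walk ≡ walkParity S₁ walk
    same = trans (walkParity-resign S₁ S₂ X resign walk)
          (trans (cong (walkParity S₁ walk ℙ.+_) (cancel (pbit (X base))))
                 (ℙ.+-identityʳ _))

  signedPower-resp-≈ :
    ∀ (S₁ S₂ : Signature G) → S₁ ≈ S₂ → ∀ r {u v} →
    HasShortPath S₁ r 1ℙ u v × HasShortPath S₁ r 0ℙ u v →
    HasShortPath S₂ r 1ℙ u v × HasShortPath S₂ r 0ℙ u v
  signedPower-resp-≈ S₁ S₂ (X , resign) r {u} {v} (P₁ , P₂) =
    split (pbit (X u) ℙ.+ pbit (X v)) refl
    where
    shift : ∀ {π} s → pbit (X u) ℙ.+ pbit (X v) ≡ s →
            HasShortPath S₁ r π u v → HasShortPath S₂ r (π ℙ.+ s) u v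
    shift s eq (P , isP , P≤r , P≡π) =
      P , isP , P≤r , trans (walkParity-resign S₁ S₂ X resign P) (cong₂ ℙ._+_ P≡π eq)

    split : ∀ s → pbit (X u) ℙ.+ pbit (X v) ≡ s →
            HasShortPath S₂ r 1ℙ u v × HasShortPath S₂ r 0ℙ u v
    split 0ℙ eq = shift 0ℙ eq P₁ , shift 0ℙ eq P₂
    split 1ℙ eq = shift 1ℙ eq P₂ , shift 1ℙ eq P₁

------------------------------------------------------------------------
-- Planarity

-- A drawing represents every edge by a simple polygonal arc with vertices
-- in ℚ².  Segments with rational endpoints that meet in ℝ² also meet in ℚ²,
-- and the common part of two such segments is a point of ℚ² or a segment
-- with ends in ℚ², so the conditions below, although they quantify over ℚ²
-- only, hold of the real arcs as well.  Conversely every finite planar graph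
-- has a drawing of this form.

Point : Set
Point = ℚ × ℚ

data OnSegment (a b x : Point) : Set where
  at : (t : ℚ) → 0ℚ ℚ.≤ t → t ℚ.≤ 1ℚ →
       proj₁ x ≡ (1ℚ ℚ.- t) ℚ.* proj₁ a ℚ.+ t ℚ.* proj₁ b →
       proj₂ x ≡ (1ℚ ℚ.- t) ℚ.* proj₂ a ℚ.+ t ℚ.* proj₂ b →
       OnSegment a b x

-- The polygonal line from a to b that bends successively at the listed points.
OnArc : Point → List Point → Point → Point → Set
OnArc a []       b x = OnSegment a b x
OnArc a (c ∷ cs) b x = OnSegment a c x ⊎ OnArc c cs b x

SimpleArc : Point → List Point → Point → Set
SimpleArc a []       b = ⊤
SimpleArc a (c ∷ cs) b =
  (∀ x → OnSegment a c x → OnArc c cs b x → x ≡ c) × SimpleArc c cs b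

record PlaneDrawing {V : Set} (G : Graph V) : Set where
  open Graph G
  field
    point     : V → Point
    point-inj : Injective _≡_ _≡_ point
    -- only the values at adjacent pairs matter
    bends     : V → V → List Point
    bends-sym : ∀ {u v} → u — v → bends v u ≡ List.reverse (bends u v)

  OnEdge : V → V → Point → Set
  OnEdge u v = OnArc (point u) (bends u v) (point v)

  Interior : V → V → Point → Set
  Interior u v x = OnEdge u v x × x ≢ point u × x ≢ point v

  field
    simple          : ∀ {u v} → u — v → SimpleArc (point u) (bends u v) (point v)
    avoids-vertices : ∀ {u v} → u — v → ∀ w → ¬ Interior u v (point w)
    avoids-edges    : ∀ {u v u′ v′} → u — v → u′ — v′ →
                      ∀ x → Interior u v x → OnEdge u′ v′ x →
                      (u ≡ u′ × v ≡ v′) ⊎ (u ≡ v′ × v ≡ u′)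

Planar : {V : Set} → Graph V → Set
Planar = PlaneDrawing

{-# OPTIONS --safe #-}

-- Start from an edge uv of label 0 together with a parallel gadget between u
-- and v.  A gadget whose u–v paths have length ℓ > 1 is a subdivided K₄: edges
-- ua and bv, a path of length 2k − ℓ from a to b with one negative edge, and
-- two gadgets of path length ℓ − 1, the upper one between a and v, the lower
-- one between u and b; a gadget with ℓ = 1 is an edge.  The cycle
-- u a v b of this K₄ is balanced and its faces are unbalanced 2k-cycles.
--
-- With ℓ = 2k − 1 at the top, the innermost gadgets are 2^(2k−2) disjoint
-- edges, and each part receives one end of every such edge.  Two ends in
-- different halves of a gadget are joined by two walks of equal sign through
-- u and v, of total length 2ℓ, and by two walks of the other sign, through the
-- path ab and around the gadget, of total length 4k − 2.  So the shorter one of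
-- each pair has length at most 2k − 1, hence at most 2k − 2 by parity, and it
-- contains a path of the same sign because shorter closed walks are balanced.
--
-- For the unbalanced-girth, the edges are labelled by 0, …, 2k − 1, the label 0
-- marking the negative edges, in such a way that in a closed walk all labels
-- occur equally often modulo 2; an unbalanced one therefore has length ≥ 2k.
module Submission where

open import Defs
open import Algebra.Bundles using (CommutativeRing)
open import Algebra.Properties.CommutativeSemigroup using (interchange)
open import Data.Bool.Base using (Bool; true; false; not; _xor_; T)
open import Data.Bool.Properties using (not-involutive; xor-comm; xor-same; xor-identityʳ; xor-∧-commutativeRing; T-≡)
open import Data.Empty using (⊥; ⊥-elim)
open import Data.Fin.Base using (Fin; zero; suc; fromℕ; inject₁; toℕ; remQuot; combine)
open import Data.Fin.Induction using (<-weakInduction)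
import Data.Fin.Properties as Fin
open import Data.Fin.Relation.Unary.Top using (View; ‵fromℕ; ‵inject₁; view; view-fromℕ; view-inject₁)
open import Data.Integer.Base as ℤ using (ℤ; +_; 0ℤ; 1ℤ; -1ℤ; +≤+; +<+)
import Data.Integer.Properties as ℤ
import Data.Integer.Tactic.RingSolver as ℤ-Solver
open import Data.List.Base as List using (List; []; _∷_)
import Data.List.Membership.DecPropositional as DecMembership
open import Data.List.Membership.Propositional using (_∈_)
open import Data.List.Relation.Unary.All using ([]; _∷_)
import Data.List.Relation.Unary.All.Properties as All
open import Data.List.Relation.Unary.AllPairs using ([]; _∷_)
open import Data.List.Relation.Unary.Any as Any using (here; there)
open import Data.List.Relation.Unary.Any.Properties using (lookup-index)
open import Data.Maybe.Base using (Maybe; just; nothing)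
open import Data.Nat.Base using (ℕ; zero; suc; z≤n; s≤s; parity; _+_; _*_; _∸_; _^_; _≤_; _<_; _≡ᵇ_; _<ᵇ_)
import Data.Nat.Properties as ℕ
import Data.Nat.Tactic.RingSolver as ℕ-Solver
open import Data.Parity.Base as ℙ using (Parity; 0ℙ; 1ℙ)
import Data.Parity.Properties as ℙ
open import Data.Product.Base using (Σ-syntax; ∃-syntax; _×_; _,_; proj₁; proj₂)
open import Data.Rational.Base as ℚ using (ℚ; 0ℚ; 1ℚ; toℚᵘ; fromℚᵘ)
import Data.Rational.Properties as ℚ
open import Algebra.Properties.Group ℚ.+-0-group using (⁻¹-involutive)
open import Data.Rational.Solver using (module +-*-Solver)
open import Data.Rational.Unnormalised.Base as ℚᵘ using (mkℚᵘ; *≡*)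
import Data.Rational.Unnormalised.Properties as ℚᵘ
open import Data.Sum.Base as Sum using (_⊎_; inj₁; inj₂)
open import Data.Sum.Function.Propositional using (_⊎-↔_)
open import Data.Unit.Base using (tt)
open import Data.Vec.Base as Vec using (Vec; []; _∷_; replicate)
open import Function.Base using (_∘_; _$_; id)
open import Function.Bundles using (_↔_; mk↔ₛ′; mk⇔; Equivalence; Inverse)
open import Function.Properties.Inverse using (↔-refl; ↔-sym; ↔-trans)
open import Relation.Binary.Definitions using (DecidableEquality; tri<; tri≈; tri>)
open import Relation.Binary.PropositionalEquality
import Relation.Binary.Reasoning.Setoid as SetoidReasoning
open import Relation.Nullary using (Dec; yes; no; ¬_; does)
open import Relation.Nullary.Decidable using (map′; does-⇔; _⊎-dec_; _×-dec_; dec-true; dec-false)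

private
  variable
    m n : ℕ

-- Gadgets

-- The gadget Vertex m n has u–v paths of length m + 1 and is completed by an
-- outer path of length n + 1 to unbalanced cycles of length m + n + 2 = 2k.
-- Here left = u, right = v, thread zero = a, apex = b.
data Inner : ℕ → ℕ → Set where
  thread      : Fin (suc n) → Inner (suc m) n
  apex        : Inner (suc m) n
  upper lower : Inner m (suc n) → Inner (suc m) n

data Vertex (m n : ℕ) : Set where
  left right : Vertex m n
  inner      : Inner m n → Vertex m n

-- The outer path of a smaller gadget is the old outer path prolonged by `first` (upper) or by
-- `last` (lower), hence the index `suc n`. The two images are disjoint.
ι₁ ι₂ : Vertex m (suc n) → Vertex (suc m) n
ι₁ left      = inner (thread zero)
ι₁ right     = right
ι₁ (inner x) = inner (upper x)
ι₂ left      = left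
ι₂ right     = inner apex
ι₂ (inner x) = inner (lower x)

data Edge : ℕ → ℕ → Set where
  leaf        : Edge zero n
  first last  : Edge (suc m) n
  step        : Fin (suc n) → Edge (suc m) n
  upper lower : Edge m (suc n) → Edge (suc m) n

next′ : {j : Fin (suc n)} → View j → Inner (suc m) n
next′ ‵fromℕ       = apex
next′ (‵inject₁ i) = thread (suc i)

next : Fin (suc n) → Inner (suc m) n
next j = next′ (view j)

next-fromℕ : next {m = m} (fromℕ n) ≡ apex
next-fromℕ {n = n} = cong next′ (view-fromℕ n)

next-inject₁ : (i : Fin n) → next {m = m} (inject₁ i) ≡ thread (suc i)
next-inject₁ i = cong next′ (view-inject₁ i)

src tgt : Edge m n → Vertex m n
src leaf      = left
src first     = left
src last      = inner apex
src (step j)  = inner (thread j)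
src (upper e) = ι₁ (src e)
src (lower e) = ι₂ (src e)
tgt leaf      = right
tgt first     = inner (thread zero)
tgt last      = right
tgt (step j)  = inner (next j)
tgt (upper e) = ι₁ (tgt e)
tgt (lower e) = ι₂ (tgt e)

-- The labels on the u–v paths of the gadget are n + 1, …, n + m + 1; the path
-- from a to b carries the complementary labels 0, …, n.
label : Edge m n → ℕ
label {n = n} leaf  = suc n
label {n = n} first = suc n
label {n = n} last  = suc n
label (step j)      = toℕ j
label (upper e)     = label e
label (lower e)     = label e

-- Search over edges and enumeration of vertices.

any-edge? : {P : Edge m n → Set} → (∀ e → Dec (P e)) → Dec (∃[ e ] P e)
any-edge? {zero} P? = map′ (leaf ,_) (λ { (leaf , p) → p }) (P? leaf)
any-edge? {suc m} P? = map′
  (λ { (inj₁ p)                             → first , p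
     ; (inj₂ (inj₁ p))                      → last , p
     ; (inj₂ (inj₂ (inj₁ (j , p))))         → step j , p
     ; (inj₂ (inj₂ (inj₂ (inj₁ (e , p)))))  → upper e , p
     ; (inj₂ (inj₂ (inj₂ (inj₂ (e , p)))))  → lower e , p })
  (λ { (first , p)      → inj₁ p
     ; (last , p)      → inj₂ (inj₁ p)
     ; (step j , p)  → inj₂ (inj₂ (inj₁ (j , p)))
     ; (upper e , p) → inj₂ (inj₂ (inj₂ (inj₁ (e , p))))
     ; (lower e , p) → inj₂ (inj₂ (inj₂ (inj₂ (e , p)))) })
  (P? first ⊎-dec P? last ⊎-dec Fin.any? (P? ∘ step) ⊎-dec
   any-edge? (P? ∘ upper) ⊎-dec any-edge? (P? ∘ lower))

innerOrder : ℕ → ℕ → ℕ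
innerOrder zero    n = 0
innerOrder (suc m) n = suc (suc n + (innerOrder m (suc n) + innerOrder m (suc n)))

Inner↔ : ∀ m n → Inner m n ↔ Fin (innerOrder m n)
Inner↔ zero    n = mk↔ₛ′ (λ ()) (λ ()) (λ ()) (λ ())
Inner↔ (suc m) n =
  ↔-trans (mk↔ₛ′
    (λ { apex → inj₁ zero ; (thread j) → inj₂ (inj₁ j)
       ; (upper x) → inj₂ (inj₂ (inj₁ x)) ; (lower x) → inj₂ (inj₂ (inj₂ x)) })
    (λ { (inj₁ _) → apex ; (inj₂ (inj₁ j)) → thread j
       ; (inj₂ (inj₂ (inj₁ x))) → upper x ; (inj₂ (inj₂ (inj₂ x))) → lower x })
    (λ { (inj₁ zero) → refl ; (inj₂ (inj₁ _)) → refl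
       ; (inj₂ (inj₂ (inj₁ _))) → refl ; (inj₂ (inj₂ (inj₂ _))) → refl })
    (λ { apex → refl ; (thread _) → refl ; (upper _) → refl ; (lower _) → refl }))
  (↔-trans (↔-refl {A = Fin 1} ⊎-↔ (↔-refl ⊎-↔ (Inner↔ m (suc n) ⊎-↔ Inner↔ m (suc n))))
  (↔-trans (↔-refl {A = Fin 1} ⊎-↔ (↔-refl ⊎-↔ ↔-sym Fin.+↔⊎))
  (↔-trans (↔-refl {A = Fin 1} ⊎-↔ ↔-sym Fin.+↔⊎) (↔-sym Fin.+↔⊎))))

Vertex↔ : ∀ m n → Vertex m n ↔ Fin (2 + innerOrder m n)
Vertex↔ m n = mk↔ₛ′ to from to∘from from∘to
  where
  module I = Inverse (Inner↔ m n)
  to : Vertex m n → Fin (2 + innerOrder m n)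
  to left      = zero
  to right     = suc zero
  to (inner x) = suc (suc (I.to x))
  from : Fin (2 + innerOrder m n) → Vertex m n
  from zero          = left
  from (suc zero)    = right
  from (suc (suc i)) = inner (I.from i)
  to∘from : ∀ i → to (from i) ≡ i
  to∘from zero          = refl
  to∘from (suc zero)    = refl
  to∘from (suc (suc i)) = cong (Fin.suc ∘ suc) (I.strictlyInverseˡ i)
  from∘to : ∀ x → from (to x) ≡ x
  from∘to left      = refl
  from∘to right     = refl
  from∘to (inner x) = cong inner (I.strictlyInverseʳ x)

-- Potentials

-- A function s on ℕ vanishing at 0 and at the number of labels has
-- differences adding up to zero over all labels.  These differences, assigned
-- to the edges by label, are the coboundary of pot s.
Δ : (ℕ → Bool) → ℕ → Bool
Δ s i = s (suc i) xor s i

-- The value at a vertex is the sum of `Δ s` along a walk from u: v receives the sum `s (suc n)`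
-- over the outer path, and b that of one edge more.
potᵢ : (ℕ → Bool) → Inner m n → Bool
pot  : (ℕ → Bool) → Vertex m n → Bool
potᵢ {n = n} s (thread j) = Δ s (suc n) xor s (toℕ j)
potᵢ {n = n} s apex       = s (suc (suc n))
potᵢ {n = n} s (upper x)  = Δ s (suc n) xor potᵢ s x
potᵢ s (lower x)          = potᵢ s x
pot s left                = false
pot {n = n} s right       = s (suc n)
pot s (inner x)           = potᵢ s x

xor-cancel : ∀ x y → x xor (x xor y) ≡ y
xor-cancel false y     = refl
xor-cancel true  false = refl
xor-cancel true  true  = refl

xor-shift : ∀ c x y → (c xor x) xor (c xor y) ≡ x xor y
xor-shift false x     y = refl
xor-shift true  false y = xor-cancel true y
xor-shift true  true  y = refl

module _ (s : ℕ → Bool) (s0 : s 0 ≡ false) where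

  -- Potentials of the upper gadget are normalised at a, those of the whole gadget at u; the shift
  -- is the contribution of the edge ua.
  pot-ι₁ : (x : Vertex m (suc n)) → pot s (ι₁ x) ≡ Δ s (suc n) xor pot s x
  pot-ι₁ {n = n} left = cong (Δ s (suc n) xor_) s0
  pot-ι₁ {n = n} right with s (suc n) | s (suc (suc n))
  ... | false | false = refl
  ... | false | true  = refl
  ... | true  | false = refl
  ... | true  | true  = refl
  pot-ι₁ (inner x) = refl

  pot-ι₂ : (x : Vertex m (suc n)) → pot s (ι₂ x) ≡ pot s x
  pot-ι₂ left      = refl
  pot-ι₂ right     = refl
  pot-ι₂ (inner x) = refl

  -- At the last step the sum along ua and the path ab has to agree with the value given to b; it
  -- does because the difference at `suc n` telescopes.
  pot-next : (j : Fin (suc n)) → potᵢ s (next {m = m} j) ≡ Δ s (suc n) xor s (suc (toℕ j))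
  pot-next j with view j
  pot-next {n = n} .(fromℕ _) | ‵fromℕ rewrite Fin.toℕ-fromℕ n
    with s (suc n) | s (suc (suc n))
  ... | false | false = refl
  ... | false | true  = refl
  ... | true  | false = refl
  ... | true  | true  = refl
  pot-next .(inject₁ i) | ‵inject₁ i rewrite Fin.toℕ-inject₁ i = refl

  -- The number of labels, `m + suc (suc n)`, is the same for all nested gadgets. That `s` vanishes
  -- there matters at the innermost edges, which carry the last label.
  pot-edge : s (m + suc (suc n)) ≡ false → (e : Edge m n) →
             pot s (src e) xor pot s (tgt e) ≡ Δ s (label e)
  pot-edge {n = n} sK leaf rewrite sK = refl
  pot-edge {n = n} sK first rewrite s0 = xor-identityʳ (Δ s (suc n))
  pot-edge {n = n} sK last = refl
  pot-edge {suc m} {n} sK (step j) rewrite pot-next {n = n} {m} j =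
    trans (xor-shift (Δ s (suc n)) (s (toℕ j)) _) (xor-comm (s (toℕ j)) _)
  pot-edge {suc m} {n} sK (upper e)
    rewrite pot-ι₁ (src e) | pot-ι₁ (tgt e) =
    trans (xor-shift (Δ s (suc n)) (pot s (src e)) _)
          (pot-edge (trans (cong s (ℕ.+-suc m (suc (suc n)))) sK) e)
  pot-edge {suc m} {n} sK (lower e)
    rewrite pot-ι₂ (src e) | pot-ι₂ (tgt e) =
    pot-edge (trans (cong s (ℕ.+-suc m (suc (suc n)))) sK) e

-- Separating linear functionals

record Triple (A : Set) : Set where
  constructor ⟨_,_,_⟩
  field
    p q r : A

open Triple

Functional : Set
Functional = Triple ℤ

infix 8 _·_
_·_ : Functional → Triple ℕ → ℤ
⟨ α , β , γ ⟩ · ⟨ p , q , r ⟩ = α ℤ.* + p ℤ.+ β ℤ.* + q ℤ.+ γ ℤ.* + r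

neg : Functional → Functional
neg ⟨ α , β , γ ⟩ = ⟨ ℤ.- α , ℤ.- β , ℤ.- γ ⟩

neg-· : ∀ f X → neg f · X ≡ ℤ.- (f · X)
neg-· ⟨ α , β , γ ⟩ ⟨ p , q , r ⟩ = lemma α β γ (+ p) (+ q) (+ r)
  where
  lemma : ∀ α β γ p q r → ℤ.- α ℤ.* p ℤ.+ ℤ.- β ℤ.* q ℤ.+ ℤ.- γ ℤ.* r ≡ ℤ.- (α ℤ.* p ℤ.+ β ℤ.* q ℤ.+ γ ℤ.* r)
  lemma = ℤ-Solver.solve-∀

neg-neg : ∀ f → neg (neg f) ≡ f
neg-neg ⟨ α , β , γ ⟩ rewrite ℤ.neg-involutive α | ℤ.neg-involutive β | ℤ.neg-involutive γ = refl

-- Vertices are drawn at points given by homogeneous barycentric coordinates with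
-- respect to a triangle uvb.  The upper gadget is drawn in the triangle a v w₁ and
-- the lower one in u b w₂, where a = (1,1,1), w₁ = (2,2,1) and w₂ = (2,1,2); the
-- coordinate changes M₁ and M₂ are unimodular, so that integral functionals
-- on the small triangles extend to integral functionals (push₁, push₂).
M₁ M₂ : Triple ℕ → Triple ℕ
M₁ ⟨ p , q , r ⟩ = ⟨ p + (r + r) , p + q + (r + r) , p + r ⟩
M₂ ⟨ p , q , r ⟩ = ⟨ p + (r + r) , r , q + (r + r) ⟩

coordᵢ : Inner m n → Triple ℕ
coord  : Vertex m n → Triple ℕ
coordᵢ (thread j) = ⟨ 1 , 1 , suc (toℕ j) ⟩
coordᵢ apex       = ⟨ 0 , 0 , 1 ⟩
coordᵢ (upper x)  = M₁ (coordᵢ x)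
coordᵢ (lower x)  = M₂ (coordᵢ x)
coord left        = ⟨ 1 , 0 , 0 ⟩
coord right       = ⟨ 0 , 1 , 0 ⟩
coord (inner x)   = coordᵢ x

coord-ι₁ : (x : Vertex m (suc n)) → coord (ι₁ x) ≡ M₁ (coord x)
coord-ι₁ left      = refl
coord-ι₁ right     = refl
coord-ι₁ (inner x) = refl

coord-ι₂ : (x : Vertex m (suc n)) → coord (ι₂ x) ≡ M₂ (coord x)
coord-ι₂ left      = refl
coord-ι₂ right     = refl
coord-ι₂ (inner x) = refl

_∙_ : Functional → Vertex m n → ℤ
f ∙ x = f · coord x

-- The transposes of `M₁` and `M₂`, and their inverses.
pull₁ pull₂ push₁ push₂ : Functional → Functional
pull₁ ⟨ α , β , γ ⟩ = ⟨ α ℤ.+ β ℤ.+ γ , β , (α ℤ.+ α) ℤ.+ (β ℤ.+ β) ℤ.+ γ ⟩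
pull₂ ⟨ α , β , γ ⟩ = ⟨ α , γ , (α ℤ.+ α) ℤ.+ β ℤ.+ (γ ℤ.+ γ) ⟩
push₁ ⟨ α , β , γ ⟩ = ⟨ γ ℤ.+ ℤ.- α ℤ.+ ℤ.- β , β , (α ℤ.+ α) ℤ.+ ℤ.- γ ⟩
push₂ ⟨ α , β , γ ⟩ = ⟨ α , γ ℤ.+ ℤ.- (α ℤ.+ α) ℤ.+ ℤ.- (β ℤ.+ β) , β ⟩

pull-push₁ : ∀ f → pull₁ (push₁ f) ≡ f
pull-push₁ ⟨ α , β , γ ⟩ = cong₂ (λ x y → ⟨ x , β , y ⟩) (eq₁ α β γ) (eq₂ α β γ)
  where
  eq₁ : ∀ α β γ → γ ℤ.+ ℤ.- α ℤ.+ ℤ.- β ℤ.+ β ℤ.+ ((α ℤ.+ α) ℤ.+ ℤ.- γ) ≡ α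
  eq₁ = ℤ-Solver.solve-∀
  eq₂ : ∀ α β γ → (γ ℤ.+ ℤ.- α ℤ.+ ℤ.- β ℤ.+ (γ ℤ.+ ℤ.- α ℤ.+ ℤ.- β)) ℤ.+ (β ℤ.+ β) ℤ.+ ((α ℤ.+ α) ℤ.+ ℤ.- γ) ≡ γ
  eq₂ = ℤ-Solver.solve-∀

pull-push₂ : ∀ f → pull₂ (push₂ f) ≡ f
pull-push₂ ⟨ α , β , γ ⟩ = cong (λ x → ⟨ α , β , x ⟩) (eq α β γ)
  where
  eq : ∀ α β γ → (α ℤ.+ α) ℤ.+ (γ ℤ.+ ℤ.- (α ℤ.+ α) ℤ.+ ℤ.- (β ℤ.+ β)) ℤ.+ (β ℤ.+ β) ≡ γ
  eq = ℤ-Solver.solve-∀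

pull-neg₁ : ∀ f → pull₁ (neg f) ≡ neg (pull₁ f)
pull-neg₁ ⟨ α , β , γ ⟩ = cong₂ (λ x y → ⟨ x , ℤ.- β , y ⟩) (eq₁ α β γ) (eq₂ α β γ)
  where
  eq₁ : ∀ α β γ → ℤ.- α ℤ.+ ℤ.- β ℤ.+ ℤ.- γ ≡ ℤ.- (α ℤ.+ β ℤ.+ γ)
  eq₁ = ℤ-Solver.solve-∀
  eq₂ : ∀ α β γ → (ℤ.- α ℤ.+ ℤ.- α) ℤ.+ (ℤ.- β ℤ.+ ℤ.- β) ℤ.+ ℤ.- γ ≡ ℤ.- ((α ℤ.+ α) ℤ.+ (β ℤ.+ β) ℤ.+ γ)
  eq₂ = ℤ-Solver.solve-∀

pull-neg₂ : ∀ f → pull₂ (neg f) ≡ neg (pull₂ f)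
pull-neg₂ ⟨ α , β , γ ⟩ = cong (λ x → ⟨ ℤ.- α , ℤ.- γ , x ⟩) (eq α β γ)
  where
  eq : ∀ α β γ → (ℤ.- α ℤ.+ ℤ.- α) ℤ.+ ℤ.- β ℤ.+ (ℤ.- γ ℤ.+ ℤ.- γ) ≡ ℤ.- ((α ℤ.+ α) ℤ.+ β ℤ.+ (γ ℤ.+ γ))
  eq = ℤ-Solver.solve-∀

∙-ι₁ : ∀ f (x : Vertex m (suc n)) → f ∙ ι₁ x ≡ pull₁ f ∙ x
∙-ι₁ f@(⟨ α , β , γ ⟩) x = trans (cong (f ·_) (coord-ι₁ x)) (eq α β γ (+ p X) (+ q X) (+ r X))
  where
  X = coord x
  eq : ∀ α β γ p q r → α ℤ.* (p ℤ.+ (r ℤ.+ r)) ℤ.+ β ℤ.* (p ℤ.+ q ℤ.+ (r ℤ.+ r)) ℤ.+ γ ℤ.* (p ℤ.+ r) ≡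
                       (α ℤ.+ β ℤ.+ γ) ℤ.* p ℤ.+ β ℤ.* q ℤ.+ ((α ℤ.+ α) ℤ.+ (β ℤ.+ β) ℤ.+ γ) ℤ.* r
  eq = ℤ-Solver.solve-∀

∙-ι₂ : ∀ f (x : Vertex m (suc n)) → f ∙ ι₂ x ≡ pull₂ f ∙ x
∙-ι₂ f@(⟨ α , β , γ ⟩) x = trans (cong (f ·_) (coord-ι₂ x)) (eq α β γ (+ p X) (+ q X) (+ r X))
  where
  X = coord x
  eq : ∀ α β γ p q r → α ℤ.* (p ℤ.+ (r ℤ.+ r)) ℤ.+ β ℤ.* r ℤ.+ γ ℤ.* (q ℤ.+ (r ℤ.+ r)) ≡
                       α ℤ.* p ℤ.+ γ ℤ.* q ℤ.+ ((α ℤ.+ α) ℤ.+ β ℤ.+ (γ ℤ.+ γ)) ℤ.* r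
  eq = ℤ-Solver.solve-∀

-- This makes f positive in the interior of the segment xy; hence separated
-- segments meet at most in common ends.
record Positive (f : Functional) (x y : Vertex m n) : Set where
  constructor pos
  field
    ≥0₁ : 0ℤ ℤ.≤ f ∙ x
    ≥0₂ : 0ℤ ℤ.≤ f ∙ y
    >0  : 0ℤ ℤ.< f ∙ x ⊎ 0ℤ ℤ.< f ∙ y

Negative : Functional → Vertex m n → Vertex m n → Set
Negative f = Positive (neg f)

record Separated (x y x′ y′ : Vertex m n) : Set where
  constructor sep
  field
    functional : Functional
    positive   : Positive functional x y
    negative   : Negative functional x′ y′

SeparatedEdges : Edge m n → Edge m n → Set
SeparatedEdges e e′ = Separated (src e) (tgt e) (src e′) (tgt e′)

Separated-sym : {x y x′ y′ : Vertex m n} → Separated x y x′ y′ → Separated x′ y′ x y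
Separated-sym {x = x} {y} (sep f P N) =
  sep (neg f) N (subst (λ g → Positive g x y) (sym (neg-neg f)) P)

Positive-ι₁ : ∀ f {x y : Vertex m (suc n)} → Positive (pull₁ f) x y → Positive f (ι₁ x) (ι₁ y)
Positive-ι₁ f {x} {y} (pos x≥0 y≥0 >0)
  rewrite sym (∙-ι₁ f x) | sym (∙-ι₁ f y) = pos x≥0 y≥0 >0

Positive-ι₂ : ∀ f {x y : Vertex m (suc n)} → Positive (pull₂ f) x y → Positive f (ι₂ x) (ι₂ y)
Positive-ι₂ f {x} {y} (pos x≥0 y≥0 >0)
  rewrite sym (∙-ι₂ f x) | sym (∙-ι₂ f y) = pos x≥0 y≥0 >0

Separated-ι₁ : {x y x′ y′ : Vertex m (suc n)} → Separated x y x′ y′ → Separated (ι₁ x) (ι₁ y) (ι₁ x′) (ι₁ y′)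
Separated-ι₁ {x = x} {y} {x′} {y′} (sep f P N) = sep (push₁ f)
  (Positive-ι₁ (push₁ f) (subst (λ g → Positive g x y) (sym (pull-push₁ f)) P))
  (Positive-ι₁ (neg (push₁ f)) (subst (λ g → Positive g x′ y′)
    (sym (trans (pull-neg₁ (push₁ f)) (cong neg (pull-push₁ f)))) N))

Separated-ι₂ : {x y x′ y′ : Vertex m (suc n)} → Separated x y x′ y′ → Separated (ι₂ x) (ι₂ y) (ι₂ x′) (ι₂ y′)
Separated-ι₂ {x = x} {y} {x′} {y′} (sep f P N) = sep (push₂ f)
  (Positive-ι₂ (push₂ f) (subst (λ g → Positive g x y) (sym (pull-push₂ f)) P))
  (Positive-ι₂ (neg (push₂ f)) (subst (λ g → Positive g x′ y′)
    (sym (trans (pull-neg₂ (push₂ f)) (cong neg (pull-push₂ f)))) N))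

nonneg-value : ∀ A B C X → ⟨ + A , + B , + C ⟩ · X ≡ + (A * p X + B * q X + C * r X)
nonneg-value A B C ⟨ p , q , r ⟩ =
  sym (cong₂ ℤ._+_ (cong₂ ℤ._+_ (ℤ.pos-* A p) (ℤ.pos-* B q)) (ℤ.pos-* C r))

nonneg : ∀ A B C X → 0ℤ ℤ.≤ ⟨ + A , + B , + C ⟩ · X
nonneg A B C X rewrite nonneg-value A B C X = +≤+ z≤n

-- Used both to show functionals positive and to normalise the homogeneous coordinates.
weight>0 : (x : Vertex m n) → let X = coord x in 0 < p X + q X + r X
weight>0 left = s≤s z≤n
weight>0 right = s≤s z≤n
weight>0 (inner apex) = s≤s z≤n
weight>0 (inner (thread j)) = s≤s z≤n
weight>0 (inner (upper x)) = ℕ.≤-trans (weight>0 (inner x)) (bound (p X) (q X) (r X))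
  where
  X = coordᵢ x
  bound : ∀ p q r → p + q + r ≤ p + (r + r) + (p + q + (r + r)) + (p + r)
  bound p q r = ℕ.≤-trans (ℕ.+-monoʳ-≤ (p + q) (ℕ.m≤m+n r r))
    (ℕ.≤-trans (ℕ.m≤n+m _ (p + (r + r))) (ℕ.m≤m+n _ (p + r)))
weight>0 (inner (lower x)) = ℕ.≤-trans (weight>0 (inner x)) (bound (p X) (q X) (r X))
  where
  X = coordᵢ x
  bound : ∀ p q r → p + q + r ≤ p + (r + r) + r + (q + (r + r))
  bound p q r = ℕ.≤-trans (ℕ.≤-reflexive (ℕ.+-assoc p q r))
    (ℕ.+-mono-≤ (ℕ.≤-trans (ℕ.m≤m+n p (r + r)) (ℕ.m≤m+n _ r)) (ℕ.+-monoʳ-≤ q (ℕ.m≤m+n r r)))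

-- Only u lies at its corner of the triangle: the triangle a v w₁ avoids this corner, and in u b w₂
-- it is again the corner belonging to the left end.
non-left : (x : Vertex m n) → x ≡ left ⊎ 0 < q (coord x) + r (coord x)
non-left left = inj₁ refl
non-left right = inj₂ (s≤s z≤n)
non-left (inner apex) = inj₂ (s≤s z≤n)
non-left (inner (thread j)) = inj₂ (s≤s z≤n)
non-left (inner (upper x)) = inj₂ (ℕ.≤-trans (weight>0 (inner x)) (bound (p X) (q X) (r X)))
  where
  X = coordᵢ x
  bound : ∀ p q r → p + q + r ≤ p + q + (r + r) + (p + r)
  bound p q r = ℕ.≤-trans (ℕ.+-monoʳ-≤ (p + q) (ℕ.m≤m+n r r)) (ℕ.m≤m+n _ (p + r))
non-left (inner (lower x)) with inj₂ >0 ← non-left (inner x) =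
  inj₂ (ℕ.≤-trans >0 (bound (q X) (r X)))
  where
  X = coordᵢ x
  bound : ∀ q r → q + r ≤ r + (q + (r + r))
  bound q r = ℕ.≤-trans (ℕ.+-monoʳ-≤ q (ℕ.m≤m+n r r)) (ℕ.m≤n+m _ r)

non-right : (x : Vertex m n) → x ≡ right ⊎ 0 < p (coord x) + r (coord x)
non-right left = inj₂ (s≤s z≤n)
non-right right = inj₁ refl
non-right (inner apex) = inj₂ (s≤s z≤n)
non-right (inner (thread j)) = inj₂ (s≤s z≤n)
non-right (inner (upper x)) with inj₂ >0 ← non-right (inner x) =
  inj₂ (ℕ.≤-trans >0 (ℕ.m≤n+m _ (p X + (r X + r X))))
  where X = coordᵢ x
non-right (inner (lower x)) = inj₂ (ℕ.≤-trans (weight>0 (inner x)) (bound (p X) (q X) (r X)))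
  where
  X = coordᵢ x
  bound : ∀ p q r → p + q + r ≤ p + (r + r) + (q + (r + r))
  bound p q r = ℕ.≤-trans (ℕ.≤-reflexive (ℕ.+-assoc p q r))
    (ℕ.+-mono-≤ (ℕ.m≤m+n p (r + r)) (ℕ.+-monoʳ-≤ q (ℕ.m≤m+n r r)))

positive₁₁₁ : ∀ A B C (x : Vertex m n) → 0ℤ ℤ.< ⟨ + suc A , + suc B , + suc C ⟩ ∙ x
positive₁₁₁ A B C x rewrite nonneg-value (suc A) (suc B) (suc C) (coord x) =
  +<+ (ℕ.≤-trans (weight>0 x) (bound (p X) (q X) (r X)))
  where
  X = coord x
  bound : ∀ p q r → p + q + r ≤ suc A * p + suc B * q + suc C * r
  bound p q r = ℕ.+-mono-≤ (ℕ.+-mono-≤ (ℕ.m≤m+n p _) (ℕ.m≤m+n q _)) (ℕ.m≤m+n r _)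

-- By `non-left` such a functional can vanish at u alone, and two distinct vertices are not both u.
positive₀₁₁ : ∀ A B C {x y : Vertex m n} → x ≢ y → Positive ⟨ + A , + suc B , + suc C ⟩ x y
positive₀₁₁ A B C {x} {y} x≢y =
  pos (nonneg A (suc B) (suc C) (coord x)) (nonneg A (suc B) (suc C) (coord y)) (choose (non-left x) (non-left y))
  where
  f = ⟨ + A , + suc B , + suc C ⟩
  bound : ∀ p q r → q + r ≤ A * p + suc B * q + suc C * r
  bound p q r = ℕ.+-mono-≤ (ℕ.≤-trans (ℕ.m≤m+n q _) (ℕ.m≤n+m _ (A * p))) (ℕ.m≤m+n r _)
  value>0 : ∀ z → 0 < q (coord z) + r (coord z) → 0ℤ ℤ.< f ∙ z
  value>0 z >0 rewrite nonneg-value A (suc B) (suc C) (coord z) =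
    +<+ (ℕ.≤-trans >0 (bound (p (coord z)) (q (coord z)) (r (coord z))))
  choose : x ≡ left ⊎ _ → y ≡ left ⊎ _ → 0ℤ ℤ.< f ∙ x ⊎ 0ℤ ℤ.< f ∙ y
  choose (inj₂ >0)   _           = inj₁ (value>0 x >0)
  choose (inj₁ _)    (inj₂ >0)   = inj₂ (value>0 y >0)
  choose (inj₁ refl) (inj₁ refl) = ⊥-elim (x≢y refl)

positive₁₀₁ : ∀ A B C {x y : Vertex m n} → x ≢ y → Positive ⟨ + suc A , + B , + suc C ⟩ x y
positive₁₀₁ A B C {x} {y} x≢y =
  pos (nonneg (suc A) B (suc C) (coord x)) (nonneg (suc A) B (suc C) (coord y)) (choose (non-right x) (non-right y))
  where
  f = ⟨ + suc A , + B , + suc C ⟩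
  bound : ∀ p q r → p + r ≤ suc A * p + B * q + suc C * r
  bound p q r = ℕ.+-mono-≤ (ℕ.≤-trans (ℕ.m≤m+n p _) (ℕ.m≤m+n _ (B * q))) (ℕ.m≤m+n r _)
  value>0 : ∀ z → 0 < p (coord z) + r (coord z) → 0ℤ ℤ.< f ∙ z
  value>0 z >0 rewrite nonneg-value (suc A) B (suc C) (coord z) =
    +<+ (ℕ.≤-trans >0 (bound (p (coord z)) (q (coord z)) (r (coord z))))
  choose : x ≡ right ⊎ _ → y ≡ right ⊎ _ → 0ℤ ℤ.< f ∙ x ⊎ 0ℤ ℤ.< f ∙ y
  choose (inj₂ >0)   _           = inj₁ (value>0 x >0)
  choose (inj₁ _)    (inj₂ >0)   = inj₂ (value>0 y >0)
  choose (inj₁ refl) (inj₁ refl) = ⊥-elim (x≢y refl)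

-- Pairwise separation of the edges.

next-elim : (P : Inner (suc m) n → Set) (j : Fin (suc n)) → (toℕ j ≡ n → P apex) →
            (∀ i → toℕ i ≡ suc (toℕ j) → P (thread i)) → P (next j)
next-elim {n = n} P j Pb Pt with view j
... | ‵fromℕ     = Pb (Fin.toℕ-fromℕ n)
... | ‵inject₁ i = Pt (suc i) (cong suc (sym (Fin.toℕ-inject₁ i)))

0≤+ : ∀ {k} → 0ℤ ℤ.≤ + k
0≤+ = +≤+ z≤n

0<+ : ∀ {k} → 0ℤ ℤ.< + suc k
0<+ = +<+ (s≤s z≤n)

step-positive : ∀ f → 0ℤ ℤ.≤ f ∙ inner {suc m} {n} apex →
  ∀ j → 0ℤ ℤ.< f · ⟨ 1 , 1 , suc (toℕ j) ⟩ → (∀ k → toℕ k ≡ suc (toℕ j) → 0ℤ ℤ.≤ f · ⟨ 1 , 1 , suc (toℕ k) ⟩) →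
  Positive f (src (step {n} {m} j)) (tgt (step {n} {m} j))
step-positive {m} {n} f apex≥0 j t>0 next≥0 =
  pos (ℤ.<⇒≤ t>0) (next-elim {m} (λ x → 0ℤ ℤ.≤ f ∙ inner x) j (λ _ → apex≥0) next≥0) (inj₁ t>0)

-- For functionals that may vanish at a but are positive on the rest of the path ab: of two
-- consecutive vertices the second is never a.
step-positive-apex : ∀ f → 0ℤ ℤ.< f ∙ inner {suc m} {n} apex →
  (∀ k → 0ℤ ℤ.≤ f · ⟨ 1 , 1 , suc (toℕ {suc n} k) ⟩) →
  (∀ k → 0ℤ ℤ.< f · ⟨ 1 , 1 , suc (suc (toℕ {suc n} k)) ⟩) →
  ∀ j → Positive f (src (step {n} {m} j)) (tgt (step {n} {m} j))
step-positive-apex {m} {n} f apex>0 t≥0 t>0 j =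
  pos (t≥0 j)
      (next-elim {m} (λ x → 0ℤ ℤ.≤ f ∙ inner x) j (λ _ → ℤ.<⇒≤ apex>0) (λ k _ → t≥0 k))
      (inj₂ (next-elim {m} (λ x → 0ℤ ℤ.< f ∙ inner x) j (λ _ → apex>0) λ k eq →
        subst (λ l → 0ℤ ℤ.< f · ⟨ 1 , 1 , suc l ⟩) (sym eq) (t>0 j)))

module _ {m n : ℕ} where

  -- The line -p + 3q - r = 0 strictly separates the triangles a v w₁ and u b w₂: the functional
  -- pulls back to (1,3,3) on the first and its negative to (1,1,1) on the second.
  upper|lower : (x y x′ y′ : Vertex m (suc n)) → Separated (ι₁ x) (ι₁ y) (ι₂ x′) (ι₂ y′)
  upper|lower x y x′ y′ = sep ⟨ -1ℤ , + 3 , -1ℤ ⟩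
    (Positive-ι₁ _ (pos (ℤ.<⇒≤ (positive₁₁₁ 0 2 2 x)) (ℤ.<⇒≤ (positive₁₁₁ 0 2 2 y)) (inj₁ (positive₁₁₁ 0 2 2 x))))
    (Positive-ι₂ _ (pos (ℤ.<⇒≤ (positive₁₁₁ 0 0 0 x′)) (ℤ.<⇒≤ (positive₁₁₁ 0 0 0 y′)) (inj₁ (positive₁₁₁ 0 0 0 x′))))

  -- The edges may share the end a, so the line passes through a. The pulled-back coefficients
  -- (0,2,1) vanish only at that corner; the next lemmas follow the same pattern with their own
  -- common ends.
  upper|first : {x y : Vertex m (suc n)} → x ≢ y → Separated (ι₁ x) (ι₁ y) left (inner (thread zero))
  upper|first x≢y = sep ⟨ -1ℤ , + 2 , -1ℤ ⟩ (Positive-ι₁ _ (positive₀₁₁ 0 1 0 x≢y)) (pos 0≤+ 0≤+ (inj₁ 0<+))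

  upper|last : {x y : Vertex m (suc n)} → x ≢ y → Separated (ι₁ x) (ι₁ y) (inner apex) right
  upper|last x≢y = sep ⟨ + 2 , 0ℤ , -1ℤ ⟩ (Positive-ι₁ _ (positive₁₀₁ 0 0 2 x≢y)) (pos 0≤+ 0≤+ (inj₁ 0<+))

  upper|step : {x y : Vertex m (suc n)} → x ≢ y → ∀ j → Separated (ι₁ x) (ι₁ y) (src (step {n} {m} j)) (tgt (step {n} {m} j))
  upper|step x≢y j = sep ⟨ 0ℤ , 1ℤ , -1ℤ ⟩ (Positive-ι₁ _ (positive₀₁₁ 0 0 0 x≢y))
    (step-positive-apex _ 0<+ (λ _ → 0≤+) (λ _ → 0<+) j)

  lower|first : {x y : Vertex m (suc n)} → x ≢ y → Separated (ι₂ x) (ι₂ y) left (inner (thread zero))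
  lower|first x≢y = sep ⟨ 0ℤ , ℤ.- (+ 3) , + 2 ⟩ (Positive-ι₂ _ (positive₀₁₁ 0 1 0 x≢y)) (pos 0≤+ 0≤+ (inj₂ 0<+))

  lower|last : {x y : Vertex m (suc n)} → x ≢ y → Separated (ι₂ x) (ι₂ y) (inner apex) right
  lower|last x≢y = sep ⟨ 1ℤ , -1ℤ , 0ℤ ⟩ (Positive-ι₂ _ (positive₁₀₁ 0 0 0 x≢y)) (pos 0≤+ 0≤+ (inj₂ 0<+))

  lower|step : {x y : Vertex m (suc n)} → x ≢ y → ∀ j → Separated (ι₂ x) (ι₂ y) (src (step {n} {m} j)) (tgt (step {n} {m} j))
  lower|step x≢y j = sep ⟨ + 2 , ℤ.- (+ 3) , 0ℤ ⟩ (Positive-ι₂ _ (positive₁₀₁ 1 0 0 x≢y))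
    (step-positive _ 0≤+ j 0<+ (λ _ _ → 0≤+))

  first|last : SeparatedEdges (first {m} {n}) last
  first|last = sep ⟨ + 3 , -1ℤ , -1ℤ ⟩ (pos 0≤+ 0≤+ (inj₁ 0<+)) (pos 0≤+ 0≤+ (inj₁ 0<+))

  first|step : ∀ j → SeparatedEdges (first {m} {n}) (step j)
  first|step j = sep ⟨ 1ℤ , 0ℤ , -1ℤ ⟩ (pos 0≤+ 0≤+ (inj₁ 0<+)) (step-positive-apex _ 0<+ (λ _ → 0≤+) (λ _ → 0<+) j)

  last|step : ∀ j → SeparatedEdges (last {m} {n}) (step j)
  last|step j = sep ⟨ ℤ.- (+ 2) , 1ℤ , 0ℤ ⟩ (pos 0≤+ 0≤+ (inj₂ 0<+)) (step-positive _ 0≤+ j 0<+ (λ _ _ → 0≤+))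

  -- The separating line joins v to `thread j`; at `thread k` the functional has the value j - k.
  step|step : ∀ {i j} → toℕ i < toℕ j → SeparatedEdges (step {n} {m} i) (step j)
  step|step {i} {j} i<j = sep f
    (pos (ℤ.<⇒≤ (value>0 i<j)) (next-elim {m} (λ x → 0ℤ ℤ.≤ f ∙ inner x) i
      (λ i≡n → ⊥-elim (ℕ.<⇒≱ i<j (subst (toℕ j ≤_) (sym i≡n) (Fin.toℕ≤pred[n] j))))
      (λ k k≡1+i → value≥0 (subst (_≤ toℕ j) (sym k≡1+i) i<j)))
      (inj₁ (value>0 i<j)))
    (pos (ℤ.≤-reflexive (sym (trans (negvalue (toℕ j)) (ℤ.+-inverseʳ (+ toℕ j)))))
      (ℤ.<⇒≤ next>0) (inj₂ next>0))
    where
    f = ⟨ + suc (toℕ j) , 0ℤ , -1ℤ ⟩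
    value : ∀ k → f · ⟨ 1 , 1 , suc k ⟩ ≡ + toℕ j ℤ.+ ℤ.- (+ k)
    value k = eq (+ toℕ j) (+ k)
      where
      eq : ∀ j k → (1ℤ ℤ.+ j) ℤ.* 1ℤ ℤ.+ 0ℤ ℤ.* 1ℤ ℤ.+ -1ℤ ℤ.* (1ℤ ℤ.+ k) ≡ j ℤ.+ ℤ.- k
      eq = ℤ-Solver.solve-∀
    negvalue : ∀ k → neg f · ⟨ 1 , 1 , suc k ⟩ ≡ + k ℤ.+ ℤ.- (+ toℕ j)
    negvalue k = eq (+ toℕ j) (+ k)
      where
      eq : ∀ j k → ℤ.- (1ℤ ℤ.+ j) ℤ.* 1ℤ ℤ.+ 0ℤ ℤ.* 1ℤ ℤ.+ 1ℤ ℤ.* (1ℤ ℤ.+ k) ≡ k ℤ.+ ℤ.- j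
      eq = ℤ-Solver.solve-∀
    0<- : ∀ {k l} → k < l → 0ℤ ℤ.< + l ℤ.+ ℤ.- (+ k)
    0<- {k} {l} k<l = subst (ℤ._< + l ℤ.+ ℤ.- (+ k)) (ℤ.+-inverseʳ (+ k)) (ℤ.+-monoˡ-< (ℤ.- (+ k)) (+<+ k<l))
    value≥0 : ∀ {k} → k ≤ toℕ j → 0ℤ ℤ.≤ f · ⟨ 1 , 1 , suc k ⟩
    value≥0 {k} k≤j rewrite value k = ℤ.i≤j⇒0≤j-i (+≤+ k≤j)
    value>0 : ∀ {k} → k < toℕ j → 0ℤ ℤ.< f · ⟨ 1 , 1 , suc k ⟩
    value>0 {k} k<j rewrite value k = 0<- k<j
    next>0 : 0ℤ ℤ.< neg f ∙ inner (next {m = m} j)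
    next>0 = next-elim {m} (λ x → 0ℤ ℤ.< neg f ∙ inner x) j
      (λ _ → subst (λ i → 0ℤ ℤ.< i ℤ.+ 0ℤ ℤ.+ 1ℤ) (sym (ℤ.*-zeroʳ (ℤ.- (+ suc (toℕ j))))) 0<+)
      (λ k k≡1+j → subst (0ℤ ℤ.<_) (sym (negvalue (toℕ k))) (0<- (ℕ.≤-reflexive (sym k≡1+j))))

-- A hypothesis of the geometric lemmas that follow; the bipartition supplies it in `loopless`.
Loopless : ℕ → ℕ → Set
Loopless m n = (e : Edge m n) → src e ≢ tgt e

Loopless-lower : Loopless (suc m) n → Loopless m (suc n)
Loopless-lower ll e eq = ll (lower e) (cong ι₂ eq)

compare-edges : Loopless m n → (e e′ : Edge m n) → e ≡ e′ ⊎ SeparatedEdges e e′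
compare-edges {suc m} {n} ll = go
  where
  ll′ = Loopless-lower ll
  go : (e e′ : Edge (suc m) n) → e ≡ e′ ⊎ SeparatedEdges e e′
  go first     first      = inj₁ refl
  go first     last       = inj₂ first|last
  go first     (step j)   = inj₂ (first|step j)
  go first     (upper e′) = inj₂ (Separated-sym (upper|first (ll′ e′)))
  go first     (lower e′) = inj₂ (Separated-sym (lower|first (ll′ e′)))
  go last      first      = inj₂ (Separated-sym first|last)
  go last      last       = inj₁ refl
  go last      (step j)   = inj₂ (last|step j)
  go last      (upper e′) = inj₂ (Separated-sym (upper|last (ll′ e′)))
  go last      (lower e′) = inj₂ (Separated-sym (lower|last (ll′ e′)))
  go (step i)  first      = inj₂ (Separated-sym (first|step i))
  go (step i)  last       = inj₂ (Separated-sym (last|step i))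
  go (step i)  (step j)   with Fin.<-cmp i j
  ... | tri< i<j _ _ = inj₂ (step|step i<j)
  ... | tri≈ _ i≡j _ = inj₁ (cong step i≡j)
  ... | tri> _ _ j<i = inj₂ (Separated-sym (step|step j<i))
  go (step i)  (upper e′) = inj₂ (Separated-sym (upper|step (ll′ e′) i))
  go (step i)  (lower e′) = inj₂ (Separated-sym (lower|step (ll′ e′) i))
  go (upper e) first      = inj₂ (upper|first (ll′ e))
  go (upper e) last       = inj₂ (upper|last (ll′ e))
  go (upper e) (step j)   = inj₂ (upper|step (ll′ e) j)
  go (upper e) (upper e′) = Sum.map (cong upper) Separated-ι₁ (compare-edges ll′ e e′)
  go (upper e) (lower e′) = inj₂ (upper|lower (src e) (tgt e) (src e′) (tgt e′))
  go (lower e) first      = inj₂ (lower|first (ll′ e))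
  go (lower e) last       = inj₂ (lower|last (ll′ e))
  go (lower e) (step j)   = inj₂ (lower|step (ll′ e) j)
  go (lower e) (upper e′) = inj₂ (Separated-sym (upper|lower (src e′) (tgt e′) (src e) (tgt e)))
  go (lower e) (lower e′) = Sum.map (cong lower) Separated-ι₂ (compare-edges ll′ e e′)
compare-edges {zero} ll leaf leaf = inj₁ refl

-- The edge uv is the side r = 0 of the triangle. Each functional tilts this line about u or v,
-- which makes it strictly negative at the other end.
separated-from-outer : Loopless (suc m) n → (e : Edge (suc m) n) → Separated (src e) (tgt e) left right
separated-from-outer ll first    = sep ⟨ 0ℤ , -1ℤ , + 2 ⟩ (pos 0≤+ 0≤+ (inj₂ 0<+)) (pos 0≤+ 0≤+ (inj₂ 0<+))
separated-from-outer ll last     = sep ⟨ -1ℤ , 0ℤ , 1ℤ ⟩ (pos 0≤+ 0≤+ (inj₁ 0<+)) (pos 0≤+ 0≤+ (inj₁ 0<+))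
separated-from-outer ll (step j) = sep ⟨ 0ℤ , -1ℤ , + 2 ⟩
  (step-positive _ 0≤+ j (t>0 j) (λ k _ → ℤ.<⇒≤ (t>0 k))) (pos 0≤+ 0≤+ (inj₂ 0<+))
  where
  t>0 : ∀ k → 0ℤ ℤ.< ⟨ 0ℤ , -1ℤ , + 2 ⟩ · ⟨ 1 , 1 , suc (toℕ k) ⟩
  t>0 k = +<+ (ℕ.≤-trans (s≤s z≤n) (ℕ.m≤n+m _ (toℕ k)))
separated-from-outer ll (upper e) = sep ⟨ -1ℤ , 0ℤ , + 3 ⟩
  (Positive-ι₁ _ (positive₁₀₁ 1 0 0 (Loopless-lower ll e))) (pos 0≤+ 0≤+ (inj₁ 0<+))
separated-from-outer ll (lower e) = sep ⟨ 0ℤ , -1ℤ , 1ℤ ⟩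
  (Positive-ι₂ _ (positive₀₁₁ 0 0 0 (Loopless-lower ll e))) (pos 0≤+ 0≤+ (inj₂ 0<+))

-- Distinguishing vertices by functionals.

record Below (x y : Vertex m n) : Set where
  constructor below
  field
    functional : Functional
    <0 : functional ∙ x ℤ.< 0ℤ
    ≥0 : 0ℤ ℤ.≤ functional ∙ y

-- A partition: a and v belong to the upper gadget, u and b to the lower one, and the remaining
-- vertices of the path ab to neither.
data Cover {m n} : Vertex (suc m) n → Set where
  ⟨ι₁⟩ : ∀ x → Cover (ι₁ x)
  ⟨ι₂⟩ : ∀ x → Cover (ι₂ x)
  ⟨thread⟩ : ∀ j → Cover (inner (thread (suc j)))

cover : (x : Vertex (suc m) n) → Cover x
cover left                     = ⟨ι₂⟩ left
cover right                    = ⟨ι₁⟩ right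
cover (inner (thread zero))    = ⟨ι₁⟩ left
cover (inner (thread (suc j))) = ⟨thread⟩ j
cover (inner apex)             = ⟨ι₂⟩ right
cover (inner (upper x))        = ⟨ι₁⟩ (inner x)
cover (inner (lower x))        = ⟨ι₂⟩ (inner x)

push-ι₁ : ∀ f (x : Vertex m (suc n)) → f ∙ x ≡ push₁ f ∙ ι₁ x
push-ι₁ f x = trans (cong (_∙ x) (sym (pull-push₁ f))) (sym (∙-ι₁ (push₁ f) x))

push-ι₂ : ∀ f (x : Vertex m (suc n)) → f ∙ x ≡ push₂ f ∙ ι₂ x
push-ι₂ f x = trans (cong (_∙ x) (sym (pull-push₂ f))) (sym (∙-ι₂ (push₂ f) x))

Below-ι₁ : {x y : Vertex m (suc n)} → Below x y → Below (ι₁ x) (ι₁ y)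
Below-ι₁ {x = x} {y} (below f x<0 y≥0) = below (push₁ f)
  (subst (ℤ._< 0ℤ) (push-ι₁ f x) x<0) (subst (0ℤ ℤ.≤_) (push-ι₁ f y) y≥0)

Below-ι₂ : {x y : Vertex m (suc n)} → Below x y → Below (ι₂ x) (ι₂ y)
Below-ι₂ {x = x} {y} (below f x<0 y≥0) = below (push₂ f)
  (subst (ℤ._< 0ℤ) (push-ι₂ f x) x<0) (subst (0ℤ ℤ.≤_) (push-ι₂ f y) y≥0)

ι₂<ι₁ : (x y : Vertex m (suc n)) → Below (ι₂ x) (ι₁ y)
ι₂<ι₁ x y = below f
  (ℤ.neg-cancel-< (subst (0ℤ ℤ.<_) (neg-· f (coord (ι₂ x)))
    (subst (0ℤ ℤ.<_) (sym (∙-ι₂ (neg f) x)) (positive₁₁₁ 0 0 0 x))))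
  (subst (0ℤ ℤ.≤_) (sym (∙-ι₁ f y)) (nonneg 1 3 3 (coord y)))
  where f = ⟨ -1ℤ , + 3 , -1ℤ ⟩

thread<ι₁ : ∀ j (y : Vertex m (suc n)) → Below (inner (thread (suc j))) (ι₁ y)
thread<ι₁ j y = below f ℤ.-<+ (subst (0ℤ ℤ.≤_) (sym (∙-ι₁ f y)) (nonneg 0 1 1 (coord y)))
  where f = ⟨ 0ℤ , 1ℤ , -1ℤ ⟩

thread<ι₂ : ∀ j (y : Vertex m (suc n)) → Below (inner (thread (suc j))) (ι₂ y)
thread<ι₂ j y = below f ℤ.-<+ (subst (0ℤ ℤ.≤_) (sym (∙-ι₂ f y)) (nonneg 2 0 1 (coord y)))
  where f = ⟨ + 2 , ℤ.- (+ 3) , 0ℤ ⟩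

thread<thread : ∀ {i j : Fin (suc n)} → toℕ i < toℕ j → Below {suc m} (inner (thread j)) (inner (thread i))
thread<thread {i = i} {j} i<j = below f
  (subst (ℤ._< 0ℤ) (sym (value (toℕ j)))
    (subst (+ toℕ j ℤ.+ ℤ.- (+ suc (toℕ j)) ℤ.<_) (ℤ.+-inverseʳ (+ toℕ j))
      (ℤ.+-monoʳ-< (+ toℕ j) (ℤ.neg-mono-< (+<+ (ℕ.n<1+n (toℕ j)))))))
  (subst (0ℤ ℤ.≤_) (sym (value (toℕ i))) (ℤ.i≤j⇒0≤j-i (+≤+ i<j)))
  where
  f = ⟨ + toℕ j , 0ℤ , -1ℤ ⟩
  value : ∀ k → f · ⟨ 1 , 1 , suc k ⟩ ≡ + toℕ j ℤ.+ ℤ.- (+ suc k)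
  value k = eq (+ toℕ j) (+ suc k)
    where
    eq : ∀ j k → j ℤ.* 1ℤ ℤ.+ 0ℤ ℤ.* 1ℤ ℤ.+ -1ℤ ℤ.* k ≡ j ℤ.+ ℤ.- k
    eq = ℤ-Solver.solve-∀

-- Serves twice: for the injectivity of the drawing and for deciding equality of vertices.
compare-vertices : (x y : Vertex m n) → x ≡ y ⊎ (Below x y ⊎ Below y x)
compare-vertices {zero} left left = inj₁ refl
compare-vertices {zero} left right = inj₂ (inj₂ (below ⟨ 1ℤ , -1ℤ , 0ℤ ⟩ ℤ.-<+ 0≤+))
compare-vertices {zero} right left = inj₂ (inj₁ (below ⟨ 1ℤ , -1ℤ , 0ℤ ⟩ ℤ.-<+ 0≤+))
compare-vertices {zero} right right = inj₁ refl
compare-vertices {suc m} x y with cover x | cover y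
... | ⟨ι₁⟩ x′    | ⟨ι₁⟩ y′    = Sum.map (cong ι₁) (Sum.map Below-ι₁ Below-ι₁) (compare-vertices x′ y′)
... | ⟨ι₂⟩ x′    | ⟨ι₂⟩ y′    = Sum.map (cong ι₂) (Sum.map Below-ι₂ Below-ι₂) (compare-vertices x′ y′)
... | ⟨ι₁⟩ x′    | ⟨ι₂⟩ y′    = inj₂ (inj₂ (ι₂<ι₁ y′ x′))
... | ⟨ι₂⟩ x′    | ⟨ι₁⟩ y′    = inj₂ (inj₁ (ι₂<ι₁ x′ y′))
... | ⟨thread⟩ i | ⟨ι₁⟩ y′    = inj₂ (inj₁ (thread<ι₁ i y′))
... | ⟨thread⟩ i | ⟨ι₂⟩ y′    = inj₂ (inj₁ (thread<ι₂ i y′))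
... | ⟨ι₁⟩ x′    | ⟨thread⟩ j = inj₂ (inj₂ (thread<ι₁ j x′))
... | ⟨ι₂⟩ x′    | ⟨thread⟩ j = inj₂ (inj₂ (thread<ι₂ j x′))
... | ⟨thread⟩ i | ⟨thread⟩ j with Fin.<-cmp i j
...   | tri< i<j _ _  = inj₂ (inj₂ (thread<thread (s≤s i<j)))
...   | tri≈ _ refl _ = inj₁ refl
...   | tri> _ _ j<i  = inj₂ (inj₁ (thread<thread (s≤s j<i)))

Below-irrefl : {x y : Vertex m n} → Below x y → x ≢ y
Below-irrefl (below f x<0 y≥0) refl = ℤ.<⇒≱ x<0 y≥0

-- The straight-line drawing

ι : ℤ → ℚ
ι z = fromℚᵘ (mkℚᵘ z 0)

ι-+ : ∀ y z → ι (y ℤ.+ z) ≡ ι y ℚ.+ ι z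
ι-+ y z = ℚ.toℚᵘ-injective $ begin
  toℚᵘ (ι (y ℤ.+ z))               ≈⟨ ℚ.toℚᵘ-fromℚᵘ _ ⟩
  mkℚᵘ (y ℤ.+ z) 0                 ≈⟨ *≡* (eq y z) ⟩
  mkℚᵘ y 0 ℚᵘ.+ mkℚᵘ z 0           ≈⟨ ℚᵘ.+-cong (ℚ.toℚᵘ-fromℚᵘ (mkℚᵘ y 0)) (ℚ.toℚᵘ-fromℚᵘ (mkℚᵘ z 0)) ⟨
  toℚᵘ (ι y) ℚᵘ.+ toℚᵘ (ι z)       ≈⟨ ℚ.toℚᵘ-homo-+ (ι y) (ι z) ⟨
  toℚᵘ (ι y ℚ.+ ι z)               ∎
  where
  open SetoidReasoning ℚᵘ.≃-setoid
  eq : ∀ y z → (y ℤ.+ z) ℤ.* ℤ.1ℤ ≡ (y ℤ.* ℤ.1ℤ ℤ.+ z ℤ.* ℤ.1ℤ) ℤ.* ℤ.1ℤ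
  eq = ℤ-Solver.solve-∀

ι-* : ∀ y z → ι (y ℤ.* z) ≡ ι y ℚ.* ι z
ι-* y z = ℚ.toℚᵘ-injective $ begin
  toℚᵘ (ι (y ℤ.* z))               ≈⟨ ℚ.toℚᵘ-fromℚᵘ _ ⟩
  mkℚᵘ y 0 ℚᵘ.* mkℚᵘ z 0           ≈⟨ ℚᵘ.*-cong (ℚ.toℚᵘ-fromℚᵘ (mkℚᵘ y 0)) (ℚ.toℚᵘ-fromℚᵘ (mkℚᵘ z 0)) ⟨
  toℚᵘ (ι y) ℚᵘ.* toℚᵘ (ι z)       ≈⟨ ℚ.toℚᵘ-homo-* (ι y) (ι z) ⟨
  toℚᵘ (ι y ℚ.* ι z)               ∎
  where open SetoidReasoning ℚᵘ.≃-setoid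

ι-neg : ∀ z → ι (ℤ.- z) ≡ ℚ.- ι z
ι-neg z = ℚ.toℚᵘ-injective $ begin
  toℚᵘ (ι (ℤ.- z))                 ≈⟨ ℚ.toℚᵘ-fromℚᵘ _ ⟩
  ℚᵘ.- mkℚᵘ z 0                    ≈⟨ ℚᵘ.-‿cong (ℚ.toℚᵘ-fromℚᵘ (mkℚᵘ z 0)) ⟨
  ℚᵘ.- toℚᵘ (ι z)                  ≈⟨ ℚ.toℚᵘ-homo‿- (ι z) ⟨
  toℚᵘ (ℚ.- ι z)                   ∎
  where open SetoidReasoning ℚᵘ.≃-setoid

ι-nonNeg : ∀ {z} → 0ℤ ℤ.≤ z → 0ℚ ℚ.≤ ι z
ι-nonNeg {+ k} _ = ℚ.nonNegative⁻¹ (ι (+ k)) {{ℚ.normalize-nonNeg k 1}}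

ι-pos : ∀ {z} → 0ℤ ℤ.< z → 0ℚ ℚ.< ι z
ι-pos {+ suc k} _ = ℚ.positive⁻¹ (ι (+ suc k)) {{ℚ.normalize-pos (suc k) 1}}
ι-pos {+ 0} (ℤ.+<+ ())

infix 8 _⊙_
-- The functional as an affine function on the plane, 1 - x - y being the third barycentric
-- coordinate of (x, y).
_⊙_ : Functional → Point → ℚ
⟨ α , β , γ ⟩ ⊙ (x , y) = ι α ℚ.* x ℚ.+ ι β ℚ.* y ℚ.+ ι γ ℚ.* (1ℚ ℚ.- x ℚ.- y)

module _ where
  open +-*-Solver

  ⊙-segment : ∀ f t {c d x} → proj₁ x ≡ (1ℚ ℚ.- t) ℚ.* proj₁ c ℚ.+ t ℚ.* proj₁ d →
              proj₂ x ≡ (1ℚ ℚ.- t) ℚ.* proj₂ c ℚ.+ t ℚ.* proj₂ d →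
              f ⊙ x ≡ (1ℚ ℚ.- t) ℚ.* (f ⊙ c) ℚ.+ t ℚ.* (f ⊙ d)
  ⊙-segment ⟨ α , β , γ ⟩ t {a₁ , a₂} {b₁ , b₂} {x₁ , x₂} refl refl =
    solve 8 (λ α β γ t a₁ a₂ b₁ b₂ →
      α :* ((con 1ℚ :- t) :* a₁ :+ t :* b₁) :+ β :* ((con 1ℚ :- t) :* a₂ :+ t :* b₂) :+
      γ :* (con 1ℚ :- ((con 1ℚ :- t) :* a₁ :+ t :* b₁) :- ((con 1ℚ :- t) :* a₂ :+ t :* b₂))
      := (con 1ℚ :- t) :* (α :* a₁ :+ β :* a₂ :+ γ :* (con 1ℚ :- a₁ :- a₂)) :+
         t :* (α :* b₁ :+ β :* b₂ :+ γ :* (con 1ℚ :- b₁ :- b₂)))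
      refl (ι α) (ι β) (ι γ) t a₁ a₂ b₁ b₂

  ⊙-neg : ∀ f x → neg f ⊙ x ≡ ℚ.- (f ⊙ x)
  ⊙-neg ⟨ α , β , γ ⟩ (x , y) rewrite ι-neg α | ι-neg β | ι-neg γ =
    solve 5 (λ α β γ x y →
      :- α :* x :+ :- β :* y :+ :- γ :* (con 1ℚ :- x :- y) := :- (α :* x :+ β :* y :+ γ :* (con 1ℚ :- x :- y)))
      refl (ι α) (ι β) (ι γ) x y

  -- With i the inverse of the total weight w, the third barycentric coordinate of (p i, q i) is r
  -- i; multiplying by w clears the denominator.
  normalise-weight : ∀ α β γ p q r w i → w ≡ p ℚ.+ q ℚ.+ r → i ℚ.* w ≡ 1ℚ →
    (α ℚ.* (p ℚ.* i) ℚ.+ β ℚ.* (q ℚ.* i) ℚ.+ γ ℚ.* (1ℚ ℚ.- p ℚ.* i ℚ.- q ℚ.* i)) ℚ.* w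
    ≡ α ℚ.* p ℚ.+ β ℚ.* q ℚ.+ γ ℚ.* r
  normalise-weight α β γ p q r w i w≡ iw≡1 = begin
    (α ℚ.* (p ℚ.* i) ℚ.+ β ℚ.* (q ℚ.* i) ℚ.+ γ ℚ.* (1ℚ ℚ.- p ℚ.* i ℚ.- q ℚ.* i)) ℚ.* w
      ≡⟨ solve 7 (λ α β γ p q w i →
           (α :* (p :* i) :+ β :* (q :* i) :+ γ :* (con 1ℚ :- p :* i :- q :* i)) :* w :=
           (α :* p :+ β :* q) :* (i :* w) :+ γ :* (w :- (p :+ q) :* (i :* w)))
           refl α β γ p q w i ⟩
    (α ℚ.* p ℚ.+ β ℚ.* q) ℚ.* (i ℚ.* w) ℚ.+ γ ℚ.* (w ℚ.- (p ℚ.+ q) ℚ.* (i ℚ.* w))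
      ≡⟨ cong₂ (λ j w → (α ℚ.* p ℚ.+ β ℚ.* q) ℚ.* j ℚ.+ γ ℚ.* (w ℚ.- (p ℚ.+ q) ℚ.* j)) iw≡1 w≡ ⟩
    (α ℚ.* p ℚ.+ β ℚ.* q) ℚ.* 1ℚ ℚ.+ γ ℚ.* (p ℚ.+ q ℚ.+ r ℚ.- (p ℚ.+ q) ℚ.* 1ℚ)
      ≡⟨ solve 6 (λ α β γ p q r →
           (α :* p :+ β :* q) :* con 1ℚ :+ γ :* (p :+ q :+ r :- (p :+ q) :* con 1ℚ) :=
           α :* p :+ β :* q :+ γ :* r)
           refl α β γ p q r ⟩
    α ℚ.* p ℚ.+ β ℚ.* q ℚ.+ γ ℚ.* r ∎
    where open ≡-Reasoning

start : ∀ p q → (1ℚ ℚ.- 0ℚ) ℚ.* p ℚ.+ 0ℚ ℚ.* q ≡ p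
start = solve 2 (λ p q → (con 1ℚ :- con 0ℚ) :* p :+ con 0ℚ :* q := p) refl
  where open +-*-Solver

start-on-segment : ∀ c d → OnSegment c d c
start-on-segment c d =
  at 0ℚ ℚ.≤-refl (ℚ.nonNegative⁻¹ 1ℚ) (sym (start (proj₁ c) (proj₁ d))) (sym (start (proj₂ c) (proj₂ d)))

weightℚ : Vertex m n → ℚ
weightℚ x = let X = coord x in ι (+ (p X + q X + r X))

weightℚ-pos : (x : Vertex m n) → ℚ.Positive (weightℚ x)
weightℚ-pos x = ℚ.positive (ι-pos (ℤ.+<+ (weight>0 x)))

1/weight : Vertex m n → ℚ
1/weight x = ℚ.1/_ (weightℚ x) {{ℚ.pos⇒nonZero (weightℚ x) {{weightℚ-pos x}}}}

-- Unfolding the normalisation of rationals is prohibitively slow.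
abstract
  point : Vertex m n → Point
  point x = let X = coord x in ι (+ p X) ℚ.* 1/weight x , ι (+ q X) ℚ.* 1/weight x

  ⊙-point : ∀ f (x : Vertex m n) → f ⊙ point x ℚ.* weightℚ x ≡ ι (f ∙ x)
  ⊙-point ⟨ α , β , γ ⟩ x = trans
    (normalise-weight (ι α) (ι β) (ι γ) (ι (+ p X)) (ι (+ q X)) (ι (+ r X)) (weightℚ x) (1/weight x)
      (trans (ι-+ (+ p X ℤ.+ + q X) (+ r X)) (cong (ℚ._+ ι (+ r X)) (ι-+ (+ p X) (+ q X))))
      (ℚ.*-inverseˡ (weightℚ x) {{ℚ.pos⇒nonZero (weightℚ x) {{weightℚ-pos x}}}}))
    (sym (trans (ι-+ (α ℤ.* + p X ℤ.+ β ℤ.* + q X) (γ ℤ.* + r X))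
      (cong₂ ℚ._+_ (trans (ι-+ (α ℤ.* + p X) (β ℤ.* + q X)) (cong₂ ℚ._+_ (ι-* α (+ p X)) (ι-* β (+ q X)))) (ι-* γ (+ r X)))))
    where
    X : Triple ℕ
    X = coord x

⊙-nonNeg : ∀ f (x : Vertex m n) → 0ℤ ℤ.≤ f ∙ x → 0ℚ ℚ.≤ f ⊙ point x
⊙-nonNeg f x fx≥0 = ℚ.*-cancelʳ-≤-pos (weightℚ x) {{weightℚ-pos x}}
  (subst₂ ℚ._≤_ (sym (ℚ.*-zeroˡ (weightℚ x))) (sym (⊙-point f x)) (ι-nonNeg fx≥0))

⊙-pos : ∀ f (x : Vertex m n) → 0ℤ ℤ.< f ∙ x → 0ℚ ℚ.< f ⊙ point x
⊙-pos f x fx>0 = ℚ.*-cancelʳ-<-nonNeg (weightℚ x) {{ℚ.pos⇒nonNeg (weightℚ x) {{weightℚ-pos x}}}}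
  (subst₂ ℚ._<_ (sym (ℚ.*-zeroˡ (weightℚ x))) (sym (⊙-point f x)) (ι-pos fx>0))

≤∧≢⇒< : ∀ {x y} → x ℚ.≤ y → x ≢ y → x ℚ.< y
≤∧≢⇒< {x} {y} x≤y x≢y with ℚ.<-cmp x y
... | tri< x<y _ _ = x<y
... | tri≈ _ x≡y _ = ⊥-elim (x≢y x≡y)
... | tri> _ _ y<x = ⊥-elim (ℚ.<-irrefl refl (ℚ.<-≤-trans y<x x≤y))

*-nonNeg : ∀ {x y} → 0ℚ ℚ.≤ x → 0ℚ ℚ.≤ y → 0ℚ ℚ.≤ x ℚ.* y
*-nonNeg {x} {y} x≥0 y≥0 = ℚ.nonNegative⁻¹ (x ℚ.* y)
  {{ℚ.nonNeg*nonNeg⇒nonNeg x {{ℚ.nonNegative x≥0}} y {{ℚ.nonNegative y≥0}}}}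

*-pos : ∀ {x y} → 0ℚ ℚ.< x → 0ℚ ℚ.< y → 0ℚ ℚ.< x ℚ.* y
*-pos {x} {y} x>0 y>0 = ℚ.positive⁻¹ (x ℚ.* y)
  {{ℚ.pos*pos⇒pos x {{ℚ.positive x>0}} y {{ℚ.positive y>0}}}}

segment-nonNeg : ∀ f {c d x} → 0ℚ ℚ.≤ f ⊙ c → 0ℚ ℚ.≤ f ⊙ d → OnSegment c d x → 0ℚ ℚ.≤ f ⊙ x
segment-nonNeg f {c} {d} {x} c≥0 d≥0 (at t t≥0 t≤1 x₁ x₂) =
  subst (0ℚ ℚ.≤_) (sym (⊙-segment f t {c} {d} {x} x₁ x₂))
    (ℚ.+-mono-≤ (*-nonNeg 1-t≥0 c≥0) (*-nonNeg t≥0 d≥0))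
  where
  1-t≥0 : 0ℚ ℚ.≤ 1ℚ ℚ.- t
  1-t≥0 = subst (ℚ._≤ 1ℚ ℚ.- t) (ℚ.+-inverseʳ t) (ℚ.+-monoˡ-≤ (ℚ.- t) t≤1)

-- Away from the ends both weights t and 1 - t are positive, so one positive end suffices.
segment-pos : ∀ f {c d x} → 0ℚ ℚ.≤ f ⊙ c → 0ℚ ℚ.≤ f ⊙ d → 0ℚ ℚ.< f ⊙ c ⊎ 0ℚ ℚ.< f ⊙ d →
              OnSegment c d x → x ≢ c → x ≢ d → 0ℚ ℚ.< f ⊙ x
segment-pos f {c} {d} {x} c≥0 d≥0 >0 (at t t≥0 t≤1 x₁ x₂) x≢c x≢d =
  subst (0ℚ ℚ.<_) (sym (⊙-segment f t {c} {d} {x} x₁ x₂)) (sum>0 >0)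
  where
  open +-*-Solver
  t≢0 : t ≢ 0ℚ
  t≢0 refl = x≢c (cong₂ _,_ (trans x₁ (start (proj₁ c) (proj₁ d))) (trans x₂ (start (proj₂ c) (proj₂ d))))
  t≢1 : t ≢ 1ℚ
  t≢1 refl = x≢d (cong₂ _,_ (trans x₁ (end (proj₁ c) (proj₁ d))) (trans x₂ (end (proj₂ c) (proj₂ d))))
    where
    end : ∀ p q → (1ℚ ℚ.- 1ℚ) ℚ.* p ℚ.+ 1ℚ ℚ.* q ≡ q
    end = solve 2 (λ p q → (con 1ℚ :- con 1ℚ) :* p :+ con 1ℚ :* q := q) refl
  t>0 : 0ℚ ℚ.< t
  t>0 = ≤∧≢⇒< t≥0 (t≢0 ∘ sym)
  1-t>0 : 0ℚ ℚ.< 1ℚ ℚ.- t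
  1-t>0 = subst (ℚ._< 1ℚ ℚ.- t) (ℚ.+-inverseʳ t) (ℚ.+-monoˡ-< (ℚ.- t) (≤∧≢⇒< t≤1 t≢1))
  sum>0 : 0ℚ ℚ.< f ⊙ c ⊎ 0ℚ ℚ.< f ⊙ d → 0ℚ ℚ.< (1ℚ ℚ.- t) ℚ.* (f ⊙ c) ℚ.+ t ℚ.* (f ⊙ d)
  sum>0 (inj₁ c>0) = ℚ.+-mono-<-≤ (*-pos 1-t>0 c>0) (*-nonNeg t≥0 d≥0)
  sum>0 (inj₂ d>0) = ℚ.+-mono-≤-< (*-nonNeg (ℚ.<⇒≤ 1-t>0) c≥0) (*-pos t>0 d>0)

0<-neg : ∀ {x} → 0ℚ ℚ.≤ ℚ.- x → 0ℚ ℚ.< x → ⊥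
0<-neg {x} -x≥0 x>0 = ℚ.<-irrefl refl (ℚ.<-≤-trans x>0
  (subst (ℚ._≤ 0ℚ) (ℚ.+-identityˡ x)
    (subst (0ℚ ℚ.+ x ℚ.≤_) (ℚ.+-inverseˡ x) (ℚ.+-monoˡ-≤ x -x≥0))))

Interior : Vertex m n → Vertex m n → Point → Set
Interior x y z = OnSegment (point x) (point y) z × z ≢ point x × z ≢ point y

separated-disjoint : {x y x′ y′ : Vertex m n} → Separated x y x′ y′ →
                     ∀ {z} → Interior x y z → OnSegment (point x′) (point y′) z → ⊥
separated-disjoint {x = x} {y} {x′} {y′} (sep f (pos x≥0 y≥0 >0) (pos x′≤0 y′≤0 _)) {z} (on , z≢x , z≢y) on′ =
  0<-neg
    (subst (0ℚ ℚ.≤_) (⊙-neg f z) (segment-nonNeg (neg f) (⊙-nonNeg (neg f) x′ x′≤0) (⊙-nonNeg (neg f) y′ y′≤0) on′))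
    (segment-pos f (⊙-nonNeg f x x≥0) (⊙-nonNeg f y y≥0) (Sum.map (⊙-pos f x) (⊙-pos f y) >0) on z≢x z≢y)

below-points : {x y : Vertex m n} → Below x y → point x ≢ point y
below-points {x = x} {y} (below f x<0 y≥0) eq = 0<-neg
  (subst (λ z → 0ℚ ℚ.≤ ℚ.- z) (sym (⊙-neg f (point x)))
    (subst (0ℚ ℚ.≤_) (trans (cong (f ⊙_) (sym eq)) (sym (⁻¹-involutive (f ⊙ point x)))) (⊙-nonNeg f y y≥0)))
  (⊙-pos (neg f) x (subst (0ℤ ℤ.<_) (sym (neg-· f (coord x))) (ℤ.neg-mono-< x<0)))

point-injective : {x y : Vertex m n} → point x ≡ point y → x ≡ y
point-injective {x = x} {y} eq with compare-vertices x y
... | inj₁ x≡y        = x≡y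
... | inj₂ (inj₁ x<y) = ⊥-elim (below-points x<y eq)
... | inj₂ (inj₂ y<x) = ⊥-elim (below-points y<x (sym eq))

-- Walks and paths

module _ {V : Set} {G : Graph V} (S : Signature G) where
  open Graph G
  open Signature S

  private
    variable
      x y z : V

  infixr 5 _++_
  _++_ : Walk G x y → Walk G y z → Walk G x z
  []      ++ w′ = w′
  (e ∷ w) ++ w′ = e ∷ (w ++ w′)

  length-++ : (w : Walk G x y) (w′ : Walk G y z) → length (w ++ w′) ≡ length w + length w′
  length-++ []      w′ = refl
  length-++ (e ∷ w) w′ = cong suc (length-++ w w′)

  edgeSign : V → V → Parity
  edgeSign x y = parity (bit (negative x y))

  walkParity-∷ : (e : x — y) (w : Walk G y z) →
                 walkParity S (e ∷ w) ≡ edgeSign x y ℙ.+ walkParity S w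
  walkParity-∷ {x} {y} e w = ℙ.+-homo-+ (bit (negative x y)) (negatives S w)

  walkParity-++ : (w : Walk G x y) (w′ : Walk G y z) →
                  walkParity S (w ++ w′) ≡ walkParity S w ℙ.+ walkParity S w′
  walkParity-++ []      w′ = refl
  walkParity-++ {x} (_∷_ {v = v} e w) w′ = begin
    walkParity S (e ∷ (w ++ w′))                             ≡⟨ walkParity-∷ e (w ++ w′) ⟩
    edgeSign x v ℙ.+ walkParity S (w ++ w′)                  ≡⟨ cong (edgeSign x v ℙ.+_) (walkParity-++ w w′) ⟩
    edgeSign x v ℙ.+ (walkParity S w ℙ.+ walkParity S w′)    ≡⟨ ℙ.+-assoc (edgeSign x v) _ _ ⟨
    edgeSign x v ℙ.+ walkParity S w ℙ.+ walkParity S w′      ≡⟨ cong (ℙ._+ walkParity S w′) (walkParity-∷ e w) ⟨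
    walkParity S (e ∷ w) ℙ.+ walkParity S w′                 ∎
    where open ≡-Reasoning

  -- Walks are closed under concatenation, with lengths and signs adding up; `shorten` turns them
  -- into paths at the end.
  Reach : V → V → ℕ → Parity → Set
  Reach x y l π = Σ[ w ∈ Walk G x y ] length w ≡ l × walkParity S w ≡ π

  infixr 5 _⊕_
  _⊕_ : ∀ {l l′ π π′} → Reach x y l π → Reach y z l′ π′ → Reach x z (l + l′) (π ℙ.+ π′)
  (w , refl , refl) ⊕ (w′ , refl , refl) = w ++ w′ , length-++ w w′ , walkParity-++ w w′

  Reach-sym : ∀ {l π} → Reach x y l π → Reach y x l π
  Reach-sym (w , refl , refl) = reverse w , length-reverse w , cong parity (negatives-reverse S w)

  private
    record Split (x : V) (p : Walk G y z) : Set where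
      field
        before : Walk G y x
        after  : Walk G x z
        glue   : before ++ after ≡ p
        isPath : IsPath p → IsPath after

    split : (p : Walk G y z) → x ∈ vertices p → Split x p
    split []      (here refl) = record { before = [] ; after = [] ; glue = refl ; isPath = id }
    split (e ∷ p) (here refl) = record { before = [] ; after = e ∷ p ; glue = refl ; isPath = id }
    split (e ∷ p) (there x∈p) = record
      { before = e ∷ before ; after = after ; glue = cong (e ∷_) glue
      ; isPath = λ { (_ ∷ uniq) → isPath uniq } }
      where open Split (split p x∈p)

  module _ (_≟_ : DecidableEquality V) {g : ℕ}
           (closed-unbalanced : ∀ {x} (w : Walk G x x) → walkParity S w ≡ 1ℙ → g ≤ length w) where

    open DecMembership _≟_ using (_∈?_)

    closed-balanced : (w : Walk G x x) → length w < g → walkParity S w ≡ 0ℙ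
    closed-balanced w w<g with walkParity S w in eq
    ... | 0ℙ = refl
    ... | 1ℙ = ⊥-elim (ℕ.<⇒≱ w<g (closed-unbalanced w eq))

    -- Induction from the end of the walk. If the new first vertex already lies on the path obtained
    -- from the rest, the closed walk cut off is shorter than g, hence balanced, and dropping it
    -- keeps the sign.
    shorten : (w : Walk G x y) → length w < g →
              Σ[ p ∈ Walk G x y ] IsPath p × length p ≤ length w × walkParity S p ≡ walkParity S w
    shorten []      _   = [] , [] ∷ [] , z≤n , refl
    shorten {x} (_∷_ {v = v} e w) w<g with shorten w (ℕ.<-trans (ℕ.n<1+n _) w<g)
    ... | p , uniq , p≤w , p≡w with x ∈? vertices p
    ...   | no x∉p  = e ∷ p , All.¬Any⇒All¬ _ x∉p ∷ uniq , s≤s p≤w ,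
      trans (walkParity-∷ e p) (trans (cong (edgeSign x v ℙ.+_) p≡w) (sym (walkParity-∷ e w)))
    ...   | yes x∈p = after , isPath uniq , after≤w , (begin
      walkParity S after                                              ≡⟨⟩
      0ℙ ℙ.+ walkParity S after                                       ≡⟨ cong (ℙ._+ walkParity S after) (closed-balanced (e ∷ before) before<g) ⟨
      walkParity S (e ∷ before) ℙ.+ walkParity S after                ≡⟨ walkParity-++ (e ∷ before) after ⟨
      walkParity S (e ∷ (before ++ after))                            ≡⟨ cong (λ p → walkParity S (e ∷ p)) glue ⟩
      walkParity S (e ∷ p)                                            ≡⟨ walkParity-∷ e p ⟩
      edgeSign x v ℙ.+ walkParity S p                                 ≡⟨ cong (edgeSign x v ℙ.+_) p≡w ⟩
      edgeSign x v ℙ.+ walkParity S w                                 ≡⟨ walkParity-∷ e w ⟨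
      walkParity S (e ∷ w)                                            ∎)
      where
      open ≡-Reasoning
      open Split (split p x∈p)
      lengths : length before + length after ≡ length p
      lengths = trans (sym (length-++ before after)) (cong length glue)
      after≤w : length after ≤ suc (length w)
      after≤w = ℕ.≤-trans (ℕ.m≤n+m _ (length before))
        (ℕ.≤-trans (ℕ.≤-reflexive lengths) (ℕ.≤-trans p≤w (ℕ.n≤1+n _)))
      before<g : suc (length before) < g
      before<g = ℕ.≤-<-trans
        (s≤s (ℕ.≤-trans (ℕ.≤-trans (ℕ.m≤m+n _ (length after)) (ℕ.≤-reflexive lengths)) p≤w)) w<g

-- The ends of the innermost edges

odd : ℕ → Bool
odd zero    = false
odd (suc k) = not (odd k)

Δ-odd : ∀ k → Δ odd k ≡ true
Δ-odd k with odd k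
... | false = refl
... | true  = refl

-- The end in the part c of the innermost edge reached by choosing the upper
-- (zero) or lower (suc zero) gadget at each level.
end : Bool → Vec (Fin 2) m → Vertex m n
end c     (zero ∷ i)     = ι₁ (end (not c) i)
end c     (suc zero ∷ i) = ι₂ (end c i)
end false []             = left
end true  []             = right

-- The bipartition is `pot odd`. The left end a of the upper gadget lies in the part opposite to u,
-- which the `not` in `end` compensates.
pot-end : odd (m + suc (suc n)) ≡ false → ∀ c (i : Vec (Fin 2) m) → pot odd (end {n = n} c i) ≡ c
pot-end K-even false [] = refl
pot-end {n = n} K-even true [] with odd n
... | false = refl
pot-end {suc m} {n} K-even c (zero ∷ i) = begin
  pot odd (ι₁ (end (not c) i))                    ≡⟨ pot-ι₁ odd refl (end (not c) i) ⟩
  Δ odd (suc n) xor pot odd (end (not c) i)       ≡⟨ cong₂ _xor_ (Δ-odd (suc n)) (pot-end K-even′ (not c) i) ⟩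
  not (not c)                                     ≡⟨ not-involutive c ⟩
  c                                               ∎
  where
  open ≡-Reasoning
  K-even′ = trans (cong odd (ℕ.+-suc m (suc (suc n)))) K-even
pot-end {suc m} {n} K-even c (suc zero ∷ i) =
  trans (pot-ι₂ odd refl (end c i)) (pot-end (trans (cong odd (ℕ.+-suc m (suc (suc n)))) K-even) c i)

bits : ∀ m → Fin (2 ^ m) → Vec (Fin 2) m
bits zero    i = []
bits (suc m) i = let d , r = remQuot {2} (2 ^ m) i in d ∷ bits m r

bits-injective : ∀ m {i j : Fin (2 ^ m)} → bits m i ≡ bits m j → i ≡ j
bits-injective zero {zero} {zero} _ = refl
bits-injective (suc m) {i} {j} eq = begin
  i              ≡⟨ Fin.combine-remQuot {2} (2 ^ m) i ⟨
  combine d t    ≡⟨ cong₂ combine (cong Vec.head eq) (bits-injective m (cong Vec.tail eq)) ⟩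
  combine d′ t′  ≡⟨ Fin.combine-remQuot {2} (2 ^ m) j ⟩
  j              ∎
  where
  open ≡-Reasoning
  d  = proj₁ (remQuot {2} (2 ^ m) i)
  t  = proj₂ (remQuot {2} (2 ^ m) i)
  d′ = proj₁ (remQuot {2} (2 ^ m) j)
  t′ = proj₂ (remQuot {2} (2 ^ m) j)

-- Short walks of both signs between innermost ends.

sgn : ℕ → Parity
sgn zero    = 1ℙ
sgn (suc _) = 0ℙ

half : ∀ r {k l} → k + l ≡ r + r → k ≤ r ⊎ l ≤ r
half r {k} {l} eq with k ℕ.≤? r
... | yes k≤r = inj₁ k≤r
... | no  k≰r = inj₂ (ℕ.+-cancelˡ-≤ k l r (ℕ.≤-trans (ℕ.≤-reflexive eq) (ℕ.+-monoˡ-≤ r (ℕ.≰⇒≥ k≰r))))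

module _ {V : Set} {G : Graph V} (S : Signature G) where

  private
    _↝[_,_]_ : V → ℕ → Parity → V → Set
    x ↝[ l , π ] y = Reach S x y l π

    infix 4 _↝[_,_]_

  -- Stated for an arbitrary vertex map so that the recursion can enter a smaller gadget by
  -- composing with `ι₁` or `ι₂`.
  Embedding : (Vertex m n → V) → Set
  Embedding f = ∀ e → f (src e) ↝[ 1 , sgn (label e) ] f (tgt e)

  -- Only the first edge of the path ab has label 0, so every nonempty initial piece has odd sign.
  thread-reach : (f : Vertex (suc m) n → V) → Embedding f →
                 f (inner (thread zero)) ↝[ suc n , 1ℙ ] f (inner apex)
  thread-reach {m} {n} f emb =
    subst₂ (λ l x → f (inner (thread zero)) ↝[ suc l , 1ℙ ] f (inner x))
      (Fin.toℕ-fromℕ n) next-fromℕ (reach-next (fromℕ n))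
    where
    reach-next : ∀ j → f (inner (thread zero)) ↝[ suc (toℕ j) , 1ℙ ] f (inner (next j))
    reach-next = <-weakInduction _ (emb (step zero)) λ i reach →
      subst₂ (λ l π → f (inner (thread zero)) ↝[ l , π ] f (inner (next (suc i))))
        (ℕ.+-comm (suc (toℕ i)) 1) refl
        (_⊕_ S {y = f (inner (thread (suc i)))}
          (subst₂ (λ l x → f (inner (thread zero)) ↝[ suc l , 1ℙ ] f (inner x))
            (Fin.toℕ-inject₁ i) (next-inject₁ i) reach)
          (emb (step (suc i))))

  record Between (x y z : V) (l : ℕ) : Set where
    field
      {l₁ l₂} : ℕ
      to      : x ↝[ l₁ , 0ℙ ] y
      from    : y ↝[ l₂ , 0ℙ ] z
      total   : l₁ + l₂ ≡ l

  -- On the way out from the innermost edge, each level adds `first` in front of an upper gadget or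
  -- `last` behind a lower one. All these labels are positive.
  end-between : (f : Vertex m n → V) → Embedding f → ∀ c i →
                Between (f left) (f (end c i)) (f right) (suc m)
  end-between f emb false [] = record { to = [] , refl , refl ; from = emb leaf ; total = refl }
  end-between f emb true  [] = record { to = emb leaf ; from = [] , refl , refl ; total = refl }
  end-between f emb c (zero ∷ i) = record
    { to = _⊕_ S (emb first) to ; from = from ; total = cong suc total }
    where open Between (end-between (f ∘ ι₁) (emb ∘ upper) (not c) i)
  end-between f emb c (suc zero ∷ i) = record
    { to = to ; from = _⊕_ S from (emb last)
    ; total = trans (sym (ℕ.+-assoc l₁ l₂ 1)) (trans (ℕ.+-comm (l₁ + l₂) 1) (cong suc total)) }
    where open Between (end-between (f ∘ ι₂) (emb ∘ lower) c i)

  Linked : ℕ → V → V → Set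
  Linked g x y = ∀ π → ∃[ l ] l ≤ g × x ↝[ l , π ] y

  Linked-sym : ∀ {g x y} → Linked g x y → Linked g y x
  Linked-sym linked π with l , l≤g , reach ← linked π = l , l≤g , Reach-sym S reach

  upper-lower-linked : (f : Vertex (suc m) n → V) → Embedding f → f left ↝[ suc n , 1ℙ ] f right →
    ∀ c i d i′ → Linked (suc m + suc n) (f (ι₁ (end c i))) (f (ι₂ (end d i′)))
  upper-lower-linked {m} {n} f emb outer c i d i′ = linked
    where
    module U = Between (end-between (f ∘ ι₁) (emb ∘ upper) c i)
    module L = Between (end-between (f ∘ ι₂) (emb ∘ lower) d i′)
    open Between
    infixr 5 _⊞_
    _⊞_ : ∀ {x y z l l′ π π′} → x ↝[ l , π ] y → y ↝[ l′ , π′ ] z → x ↝[ l + l′ , π ℙ.+ π′ ] z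
    _⊞_ = _⊕_ S
    balance : ∀ k p p′ q q′ {r} → p + p′ ≡ r → q + q′ ≡ r →
              (p + (k + q)) + (p′ + (k + q′)) ≡ (k + r) + (k + r)
    balance k p p′ q q′ refl eq = trans (rearrange k p p′ q q′) (cong (λ r → (k + (p + p′)) + (k + r)) eq)
      where
      rearrange : ∀ k p p′ q q′ → (p + (k + q)) + (p′ + (k + q′)) ≡ (k + (p + p′)) + (k + (q + q′))
      rearrange = ℕ-Solver.solve-∀
    2+m≤ : suc (suc m) ≤ suc m + suc n
    2+m≤ = s≤s (ℕ.≤-trans (ℕ.≤-reflexive (ℕ.+-comm 1 m)) (ℕ.+-monoʳ-≤ m (s≤s z≤n)))
    comm≤ : suc n + suc m ≤ suc m + suc n
    comm≤ = ℕ.≤-reflexive (ℕ.+-comm (suc n) (suc m))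
    linked : Linked (suc m + suc n) (f (ι₁ (end c i))) (f (ι₂ (end d i′)))
    -- Via the edge au, or via the edge vb; the two lengths add up to 2(m + 2).
    linked 0ℙ with half (suc (suc m)) (balance 1 U.l₁ U.l₂ L.l₁ L.l₂ U.total L.total)
    ... | inj₁ short = _ , ℕ.≤-trans short 2+m≤ ,
          Reach-sym S U.to ⊞ Reach-sym S (emb first) ⊞ L.to
    ... | inj₂ short = _ , ℕ.≤-trans short 2+m≤ ,
          U.from ⊞ Reach-sym S (emb last) ⊞ Reach-sym S L.from
    -- Via the path ab, or via v, the outer path and u. The lower gadget is now entered from the
    -- opposite end, so `L.l₁` and `L.l₂` change places.
    linked 1ℙ with half (suc n + suc m) (balance (suc n) U.l₁ U.l₂ L.l₂ L.l₁ U.total (trans (ℕ.+-comm L.l₂ L.l₁) L.total))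
    ... | inj₁ short = _ , ℕ.≤-trans short comm≤ , Reach-sym S U.to ⊞ thread-reach f emb ⊞ Reach-sym S L.from
    ... | inj₂ short = _ , ℕ.≤-trans short comm≤ , U.from ⊞ Reach-sym S outer ⊞ L.to

  -- Strings with different first entries are settled by `upper-lower-linked`. Otherwise both ends
  -- lie in one smaller gadget, whose outer walk has one more positive edge; the bound `m + suc n`,
  -- which is 2k - 1, stays the same.
  ends-linked : (f : Vertex m n → V) → Embedding f → f left ↝[ suc n , 1ℙ ] f right →
    ∀ c {i i′} → i ≢ i′ → Linked (m + suc n) (f (end c i)) (f (end c i′))
  ends-linked f emb outer c {[]} {[]} i≢i′ = ⊥-elim (i≢i′ refl)
  ends-linked {suc m} {n} f emb outer c {zero ∷ i} {zero ∷ i′} i≢i′ =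
    subst (λ g → Linked g (f (ι₁ (end (not c) i))) (f (ι₁ (end (not c) i′)))) (ℕ.+-suc m (suc n))
      (ends-linked (f ∘ ι₁) (emb ∘ upper) (_⊕_ S (Reach-sym S (emb first)) outer) (not c) (i≢i′ ∘ cong (zero ∷_)))
  ends-linked {suc m} {n} f emb outer c {zero ∷ i} {suc zero ∷ i′} i≢i′ =
    upper-lower-linked f emb outer (not c) i c i′
  ends-linked {suc m} {n} f emb outer c {suc zero ∷ i} {zero ∷ i′} i≢i′ =
    Linked-sym (upper-lower-linked f emb outer (not c) i′ c i)
  ends-linked {suc m} {n} f emb outer c {suc zero ∷ i} {suc zero ∷ i′} i≢i′ =
    subst (λ g → Linked g (f (ι₂ (end c i))) (f (ι₂ (end c i′)))) (ℕ.+-suc m (suc n))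
      (ends-linked (f ∘ ι₂) (emb ∘ lower)
        (subst (λ l → f left ↝[ l , 1ℙ ] f (inner apex)) (ℕ.+-comm (suc n) 1)
          (_⊕_ S outer (Reach-sym S (emb last))))
        c (i≢i′ ∘ cong (suc zero ∷_)))

-- The signed graph

odd-count : ℕ → List ℕ → Bool
odd-count i []       = false
odd-count i (l ∷ ls) = (i ≡ᵇ l) xor odd-count i ls

odd-count⇒∈ : ∀ i ls → odd-count i ls ≡ true → i ∈ ls
odd-count⇒∈ i (l ∷ ls) odd with i ≡ᵇ l in eq
... | true  = here (ℕ.≡ᵇ⇒≡ i l (subst T (sym eq) tt))
... | false = there (odd-count⇒∈ i ls odd)

-- Pigeonhole: different numbers occur at different positions.
all-below-member : ∀ k ls → (∀ i → i < k → i ∈ ls) → k ≤ List.length ls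
all-below-member k ls mem = Fin.injective⇒≤ {f = position} position-injective
  where
  position : Fin k → Fin (List.length ls)
  position i = Any.index (mem (toℕ i) (Fin.toℕ<n i))
  position-injective : ∀ {i j} → position i ≡ position j → i ≡ j
  position-injective {i} {j} eq = Fin.toℕ-injective
    (trans (lookup-index (mem (toℕ i) (Fin.toℕ<n i)))
      (trans (cong (List.lookup ls) eq) (sym (lookup-index (mem (toℕ j) (Fin.toℕ<n j))))))

-- Step functions provide potentials that single out one label.
<ᵇ-Δ : ∀ i l → Δ (i <ᵇ_) l ≡ (i ≡ᵇ l)
<ᵇ-Δ zero    zero    = refl
<ᵇ-Δ zero    (suc l) = refl
<ᵇ-Δ (suc i) zero    = refl
<ᵇ-Δ (suc i) (suc l) = <ᵇ-Δ i l

parity-bit-xor : ∀ x y → parity (bit (x xor y)) ≡ parity (bit x) ℙ.+ parity (bit y)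
parity-bit-xor false y     = refl
parity-bit-xor true  false = refl
parity-bit-xor true  true  = refl

-- The graph for 2k = K, with nothing as the outer edge uv.
module Construction (m : ℕ) (K-even : odd (suc m + 2) ≡ false) where

  K : ℕ
  K = suc m + 2

  V : Set
  V = Vertex (suc m) 0

  E : Set
  E = Maybe (Edge (suc m) 0)

  source target : E → V
  source (just e) = src e
  source nothing  = left
  target (just e) = tgt e
  target nothing  = right

  edgeLabel : E → ℕ
  edgeLabel (just e) = label e
  edgeLabel nothing  = 0

  data Joins (e : E) : V → V → Set where
    forward  : Joins e (source e) (target e)
    backward : Joins e (target e) (source e)

  Joins-sym : ∀ {e x y} → Joins e x y → Joins e y x
  Joins-sym forward  = backward
  Joins-sym backward = forward

  pot-along : ∀ s → s 0 ≡ false → s K ≡ false → ∀ e → pot s (source e) xor pot s (target e) ≡ Δ s (edgeLabel e)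
  pot-along s s0 sK (just e) = pot-edge s s0 sK e
  pot-along s s0 sK nothing rewrite s0 = sym (xor-identityʳ (s 1))

  pot-joins : ∀ s → s 0 ≡ false → s K ≡ false → ∀ {e x y} → Joins e x y →
              pot s x xor pot s y ≡ Δ s (edgeLabel e)
  pot-joins s s0 sK {e} forward = pot-along s s0 sK e
  pot-joins s s0 sK {e} backward =
    trans (xor-comm (pot s (target e)) (pot s (source e))) (pot-along s s0 sK e)

  part : V → Bool
  part = pot odd

  part-flips : ∀ {e x y} → Joins e x y → part x xor part y ≡ true
  part-flips {e} J = trans (pot-joins odd refl K-even J) (Δ-odd (edgeLabel e))

  joins-distinct : ∀ {e x y} → Joins e x y → part x ≢ part y
  joins-distinct {x = x} {y} J eq
    with () ← trans (sym (part-flips J)) (trans (cong (_xor part y) eq) (xor-same (part y)))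

  loopless : Loopless (suc m) 0
  loopless e eq = joins-distinct (forward {just e}) (cong part eq)

  Separated′ : E → E → Set
  Separated′ e e′ = Separated (source e) (target e) (source e′) (target e′)

  compare : ∀ e e′ → e ≡ e′ ⊎ Separated′ e e′
  compare (just e) (just e′) = Sum.map (cong just) (id) (compare-edges loopless e e′)
  compare (just e) nothing   = inj₂ (separated-from-outer loopless e)
  compare nothing  (just e)  = inj₂ (Separated-sym (separated-from-outer loopless e))
  compare nothing  nothing   = inj₁ refl

  Positive-joins : ∀ {f e x y} → Joins e x y → Positive f (source e) (target e) → Positive f x y
  Positive-joins forward  P            = P
  Positive-joins backward (pos p q >0) = pos q p (Sum.swap >0)

  joins-separated : ∀ {e e′ x y x′ y′} → Joins e x y → Joins e′ x′ y′ →
                    e ≡ e′ ⊎ Separated x y x′ y′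
  joins-separated {e} {e′} J J′ with compare e e′
  ... | inj₁ e≡e′        = inj₁ e≡e′
  ... | inj₂ (sep f P N) = inj₂ (sep f (Positive-joins J P) (Positive-joins J′ N))

  not-self-separated : {x y : V} → ¬ Separated x y x y
  not-self-separated {x} {y} (sep f (pos _ _ >0) (pos x≤0 y≤0 _)) = clash >0
    where
    impossible : ∀ z → 0ℤ ℤ.≤ neg f ∙ z → ¬ 0ℤ ℤ.< f ∙ z
    impossible z z≤0 z>0 = ℤ.<⇒≱ (ℤ.neg-mono-< z>0) (subst (0ℤ ℤ.≤_) (neg-· f (coord z)) z≤0)
    clash : ¬ (0ℤ ℤ.< f ∙ x ⊎ 0ℤ ℤ.< f ∙ y)
    clash (inj₁ x>0) = impossible x x≤0 x>0
    clash (inj₂ y>0) = impossible y y≤0 y>0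

  -- Parallel edges would be drawn as the same segment, and no segment is separated from itself.
  joins-unique : ∀ {e e′ x y} → Joins e x y → Joins e′ x y → e ≡ e′
  joins-unique J J′ with joins-separated J J′
  ... | inj₁ e≡e′ = e≡e′
  ... | inj₂ s    = ⊥-elim (not-self-separated s)

  _≟_ : DecidableEquality V
  x ≟ y with compare-vertices x y
  ... | inj₁ x≡y        = yes x≡y
  ... | inj₂ (inj₁ x<y) = no (Below-irrefl x<y)
  ... | inj₂ (inj₂ y<x) = no (Below-irrefl y<x ∘ sym)

  Joins? : ∀ e x y → Dec (Joins e x y)
  Joins? e x y = map′
    (λ { (inj₁ (refl , refl)) → forward ; (inj₂ (refl , refl)) → backward })
    (λ { forward → inj₁ (refl , refl) ; backward → inj₂ (refl , refl) })
    ((source e ≟ x ×-dec target e ≟ y) ⊎-dec (source e ≟ y ×-dec target e ≟ x))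

  any? : {P : E → Set} → (∀ e → Dec (P e)) → Dec (∃[ e ] P e)
  any? P? = map′ (λ { (inj₁ p) → nothing , p ; (inj₂ (e , p)) → just e , p })
                 (λ { (nothing , p) → inj₁ p ; (just e , p) → inj₂ (e , p) })
                 (P? nothing ⊎-dec any-edge? (P? ∘ just))

  -- An adjacency carries its edge, so labels can be read off a walk.
  graph : Graph V
  graph = record
    { _—_   = λ x y → ∃[ e ] Joins e x y
    ; —-sym = λ (e , J) → e , Joins-sym J
    ; —-irr = λ (e , J) → joins-distinct J refl
    }

  NegativeEdge : V → V → Set
  NegativeEdge x y = ∃[ e ] (Joins e x y × edgeLabel e ≡ 0)

  abstract
    negative? : ∀ x y → Dec (NegativeEdge x y)
    negative? x y = any? λ e → Joins? e x y ×-dec edgeLabel e ℕ.≟ 0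

  negative : V → V → Bool
  negative x y = does (negative? x y)

  negative-label : ∀ {e x y} → Joins e x y → negative x y ≡ (0 ≡ᵇ edgeLabel e)
  negative-label {e} {x} {y} J with edgeLabel e in eq
  ... | zero  = dec-true (negative? x y) (e , J , eq)
  ... | suc l = dec-false (negative? x y) λ (e′ , J′ , eq′) →
    ℕ.0≢1+n (trans (sym eq′) (trans (cong edgeLabel (joins-unique J′ J)) eq))

  negative-edge : ∀ x y → T (negative x y) → NegativeEdge x y
  negative-edge x y neg with negative? x y
  ... | yes edge = edge

  negative-sym : ∀ x y → negative x y ≡ negative y x
  negative-sym x y = does-⇔
    (mk⇔ (λ (e , J , l) → e , Joins-sym J , l) (λ (e , J , l) → e , Joins-sym J , l))
    (negative? x y) (negative? y x)

  signature : Signature graph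
  signature = record
    { negative     = negative
    ; negative-sym = negative-sym
    ; negative⊆E   = λ {x} {y} n → let e , J , _ = negative-edge x y n in e , J
    }

  B : SignedBipartiteGraph
  B = record
    { V = V ; graph = graph
    ; finite = record { order = _ ; enum = Vertex↔ (suc m) 0 ; _—?_ = λ x y → any? λ e → Joins? e x y }
    ; signature = signature ; part = part
    ; bipartite = λ (e , J) → joins-distinct J }

  -- Label counts and the unbalanced-girth.

  labels : ∀ {x y} → Walk graph x y → List ℕ
  labels []            = []
  labels ((e , _) ∷ w) = edgeLabel e ∷ labels w

  length-labels : ∀ {x y} (w : Walk graph x y) → List.length (labels w) ≡ length w
  length-labels []      = refl
  length-labels (_ ∷ w) = cong suc (length-labels w)

  walkParity-labels : ∀ {x y} (w : Walk graph x y) →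
                      walkParity signature w ≡ parity (bit (odd-count 0 (labels w)))
  walkParity-labels [] = refl
  walkParity-labels (_∷_ {u = x} {v = y} (e , J) w) = begin
    walkParity signature ((e , J) ∷ w)                             ≡⟨ walkParity-∷ signature (e , J) w ⟩
    parity (bit (negative x y)) ℙ.+ walkParity signature w         ≡⟨ cong₂ (λ c π → parity (bit c) ℙ.+ π) (negative-label J) (walkParity-labels w) ⟩
    parity (bit (0 ≡ᵇ edgeLabel e)) ℙ.+ parity (bit (odd-count 0 (labels w)))
                                                                   ≡⟨ parity-bit-xor (0 ≡ᵇ edgeLabel e) _ ⟨
    parity (bit (odd-count 0 (edgeLabel e ∷ labels w)))            ∎
    where open ≡-Reasoning

  xor-telescope : ∀ x y z → (x xor y) xor (y xor z) ≡ x xor z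
  xor-telescope x y z = trans (cong (_xor (y xor z)) (xor-comm x y)) (xor-shift y x z)

  pot-walk : ∀ s → s 0 ≡ false → s K ≡ false → ∀ {x y} (w : Walk graph x y) →
             List.foldr (λ l c → Δ s l xor c) false (labels w) ≡ pot s x xor pot s y
  pot-walk s s0 sK {x} [] = sym (xor-same (pot s x))
  pot-walk s s0 sK {x} {z} (_∷_ {v = y} (e , J) w) =
    trans (cong₂ _xor_ (sym (pot-joins s s0 sK J)) (pot-walk s s0 sK w))
          (xor-telescope (pot s x) (pot s y) (pot s z))

  odd-length : ∀ {x y} (w : Walk graph x y) → odd (length w) ≡ part x xor part y
  odd-length w = trans (trans (cong odd (sym (length-labels w))) (odd-sum (labels w))) (pot-walk odd refl K-even w)
    where
    odd-sum : ∀ ls → odd (List.length ls) ≡ List.foldr (λ l c → Δ odd l xor c) false ls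
    odd-sum []       = refl
    odd-sum (l ∷ ls) = cong₂ _xor_ (sym (Δ-odd l)) (odd-sum ls)

  closed-odd-count : ∀ {i x} (w : Walk graph x x) → i < K → odd-count i (labels w) ≡ odd-count 0 (labels w)
  closed-odd-count {i} {x} w i<K = xor-false _ _ (trans (sym (sum (labels w)))
    (trans (pot-walk s refl (cong (_xor true) (Equivalence.to T-≡ (ℕ.<⇒<ᵇ i<K))) w) (xor-same (pot s x))))
    where
    open CommutativeRing xor-∧-commutativeRing using (+-commutativeSemigroup)
    -- This function vanishes at 0 and, because i < K, also at K; its differences count the labels i
    -- and 0.
    s : ℕ → Bool
    s l = (i <ᵇ l) xor (0 <ᵇ l)
    xor-false : ∀ c d → c xor d ≡ false → c ≡ d
    xor-false false d    eq = sym eq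
    xor-false true  true eq = refl
    Δs : ∀ l → Δ s l ≡ (i ≡ᵇ l) xor (0 ≡ᵇ l)
    Δs l = trans (interchange +-commutativeSemigroup (i <ᵇ suc l) (0 <ᵇ suc l) (i <ᵇ l) (0 <ᵇ l))
                 (cong₂ _xor_ (<ᵇ-Δ i l) (<ᵇ-Δ 0 l))
    sum : ∀ ls → List.foldr (λ l c → Δ s l xor c) false ls ≡ odd-count i ls xor odd-count 0 ls
    sum []       = refl
    sum (l ∷ ls) = trans (cong₂ _xor_ (Δs l) (sum ls))
                         (interchange +-commutativeSemigroup (i ≡ᵇ l) (0 ≡ᵇ l) _ _)

  -- Label 0 occurs an odd number of times, hence so does each of the K labels, and each occurs at
  -- least once.
  closed-unbalanced : ∀ {x} (w : Walk graph x x) → walkParity signature w ≡ 1ℙ → K ≤ length w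
  closed-unbalanced w w≡1 = subst (K ≤_) (length-labels w) (all-below-member K (labels w)
    λ i i<K → odd-count⇒∈ i (labels w) (trans (closed-odd-count w i<K) (negatives-odd _ (trans (sym (walkParity-labels w)) w≡1))))
    where
    negatives-odd : ∀ c → parity (bit c) ≡ 1ℙ → c ≡ true
    negatives-odd true _ = refl

  short-path : ∀ {x y} (w : Walk graph x y) → length w < K →
               Σ[ p ∈ Walk graph x y ] IsPath p × length p ≤ length w × walkParity signature p ≡ walkParity signature w
  short-path = shorten signature _≟_ closed-unbalanced

  one-edge : ∀ {x y} e → Joins e x y → Reach signature x y 1 (sgn (edgeLabel e))
  one-edge {x} {y} e J = (e , J) ∷ [] , refl , (begin
    parity (bit (negative x y) + 0)  ≡⟨ cong parity (ℕ.+-identityʳ (bit (negative x y))) ⟩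
    parity (bit (negative x y))      ≡⟨ cong (parity ∘ bit) (negative-label J) ⟩
    parity (bit (0 ≡ᵇ edgeLabel e))  ≡⟨ sgn-bit (edgeLabel e) ⟩
    sgn (edgeLabel e)                ∎)
    where
    open ≡-Reasoning
    sgn-bit : ∀ l → parity (bit (0 ≡ᵇ l)) ≡ sgn l
    sgn-bit zero    = refl
    sgn-bit (suc l) = refl

  embedding : Embedding signature id
  embedding e = one-edge (just e) forward

  outer : Reach signature left right 1 1ℙ
  outer = one-edge nothing forward

  K≡3+m : K ≡ suc (suc (suc m))
  K≡3+m = cong suc (ℕ.+-comm m 2)

  -- The cycle consists of the edge uv and a positive walk of length K - 1 from v to u, shortened to
  -- a path. The lower bound for closed walks shows that the shortening loses no length.
  girth : HasUnbalancedGirth signature K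
  girth = (cycle , unbalanced , ℕ.≤-antisym (ℕ.≤-trans (s≤s path≤) (ℕ.≤-reflexive (sym K≡3+m))) K≤) ,
          λ C → closed-unbalanced (Cycle.walk C)
    where
    open Between (end-between signature id embedding false (replicate (suc m) zero))
    spine : Reach signature right left (suc (suc m)) 0ℙ
    spine = Reach-sym signature
      (subst (λ l → Reach signature left right l 0ℙ) total (_⊕_ signature to from))
    spine<K : length (proj₁ spine) < K
    spine<K rewrite proj₁ (proj₂ spine) = ℕ.≤-reflexive (sym K≡3+m)
    shortened = short-path (proj₁ spine) spine<K
    path : Walk graph right left
    path = proj₁ shortened
    path≤ : length path ≤ suc (suc m)
    path≤ = ℕ.≤-trans (proj₁ (proj₂ (proj₂ shortened))) (ℕ.≤-reflexive (proj₁ (proj₂ spine)))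
    uv : Graph._—_ graph left right
    uv = nothing , forward
    walk-unbalanced : walkParity signature (uv ∷ path) ≡ 1ℙ
    walk-unbalanced = trans (walkParity-∷ signature uv path)
      (cong₂ ℙ._+_ (cong (parity ∘ bit) (negative-label (forward {nothing})))
        (trans (proj₂ (proj₂ (proj₂ shortened))) (proj₂ (proj₂ spine))))
    K≤ : K ≤ suc (length path)
    K≤ = closed-unbalanced (uv ∷ path) walk-unbalanced
    cycle : Cycle graph
    cycle = record
      { first = uv ; rest = path ; rest-path = proj₁ (proj₂ shortened)
      ; rest-long = ℕ.≤-trans (ℕ.m≤n+m 2 m) (ℕ.≤-pred K≤) }
    unbalanced : Unbalanced signature cycle
    unbalanced = walk-unbalanced

  -- The cliques.

  clique : ∀ c → HasCliqueOfSizeAtLeast (2 ^ suc m) (induced (signedPower B (suc m)) (λ x → part x ≡ c))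
  clique c = _ , ℕ.≤-refl , (λ i → vertex i , on-part i) , adjacent
    where
    vertex : Fin (2 ^ suc m) → V
    vertex i = end c (bits (suc m) i)
    on-part : ∀ i → part (vertex i) ≡ c
    on-part i = pot-end K-even c (bits (suc m) i)
    adjacent : ∀ {i j} → i ≢ j → Graph._—_ (signedPower B (suc m)) (vertex i) (vertex j)
    adjacent {i} {j} i≢j = distinct , same-part , path 1ℙ , path 0ℙ
      where
      linked : Linked signature (suc m + 1) (vertex i) (vertex j)
      linked = ends-linked signature id embedding outer c (i≢j ∘ bits-injective (suc m))
      same-part : part (vertex i) ≡ part (vertex j)
      same-part = trans (on-part i) (sym (on-part j))
      distinct : vertex i ≢ vertex j
      -- If the two ends coincided, the walk of odd sign between them would be closed, unbalanced
      -- and shorter than K.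
      distinct eq with l , l≤ , w , refl , odd ← subst (λ x → ∃[ l ] l ≤ suc m + 1 × Reach signature (vertex i) x l 1ℙ) (sym eq) (linked 1ℙ) =
        ℕ.<⇒≱ (ℕ.≤-trans (s≤s l≤) (ℕ.≤-reflexive (cong suc (sym (ℕ.+-suc m 1))))) (closed-unbalanced w odd)
      path : ∀ π → HasShortPath signature (suc m) π (vertex i) (vertex j)
      path π with l , l≤ , w , refl , w≡π ← linked π
             with p , isPath , p≤w , p≡w ← short-path w (ℕ.≤-trans (s≤s l≤) (ℕ.≤-reflexive (cong suc (sym (ℕ.+-suc m 1))))) =
        p , isPath , ℕ.≤-trans p≤w (ℕ.≤-pred (ℕ.≤∧≢⇒< (ℕ.≤-trans l≤ (ℕ.≤-reflexive (ℕ.+-comm (suc m) 1))) w≢)) , trans p≡w w≡π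
        where
        w-even : odd (length w) ≡ false
        w-even = trans (odd-length w) (trans (cong (_xor part (vertex j)) same-part) (xor-same (part (vertex j))))
        -- The walk stays within one part at its ends and so has even length, whereas K - 1 is odd;
        -- the bound K - 1 thus improves to K - 2.
        w≢ : length w ≢ suc (suc m)
        w≢ eq with () ← trans (sym K-even) (trans (trans (cong odd K≡3+m) (cong (not ∘ odd) (sym eq))) (cong not w-even))

  -- Planarity of the whole graph.

  inner-incident : ∀ {m n} (x : Inner m n) → ∃[ e ] (src e ≡ inner x ⊎ tgt e ≡ inner x)
  inner-incident (thread j) = step j , inj₁ refl
  inner-incident apex       = last , inj₁ refl
  inner-incident (upper x) with e , end ← inner-incident x = upper e , Sum.map (cong ι₁) (cong ι₁) end
  inner-incident (lower x) with e , end ← inner-incident x = lower e , Sum.map (cong ι₂) (cong ι₂) end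

  open Graph graph using (_—_)

  -- Since each vertex is an end of an edge, `edges-meet` also keeps vertices off the interiors of
  -- edges.
  incident : ∀ x → ∃[ y ] x — y
  incident left  = right , nothing , forward
  incident right = left , nothing , backward
  incident (inner x) with inner-incident x
  ... | e , inj₁ eq = tgt e , just e , subst (λ y → Joins (just e) y (tgt e)) eq forward
  ... | e , inj₂ eq = src e , just e , subst (λ y → Joins (just e) y (src e)) eq backward

  same-ends : ∀ {e x y x′ y′} → Joins e x y → Joins e x′ y′ → (x ≡ x′ × y ≡ y′) ⊎ (x ≡ y′ × y ≡ x′)
  same-ends forward  forward  = inj₁ (refl , refl)
  same-ends forward  backward = inj₂ (refl , refl)
  same-ends backward forward  = inj₂ (refl , refl)
  same-ends backward backward = inj₁ (refl , refl)

  edges-meet : ∀ {x y x′ y′} → x — y → x′ — y′ → ∀ z → Interior x y z →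
               OnSegment (point x′) (point y′) z → (x ≡ x′ × y ≡ y′) ⊎ (x ≡ y′ × y ≡ x′)
  edges-meet {x} {y} {x′} {y′} (e , J) (e′ , J′) z int on = decide (joins-separated J J′)
    where
    decide : e ≡ e′ ⊎ Separated x y x′ y′ → (x ≡ x′ × y ≡ y′) ⊎ (x ≡ y′ × y ≡ x′)
    decide (inj₁ refl) = same-ends J J′
    decide (inj₂ s)    = ⊥-elim (separated-disjoint s int on)

  drawing : PlaneDrawing graph
  drawing = record
    { point = point ; point-inj = point-injective
    ; bends = λ _ _ → [] ; bends-sym = λ _ → refl ; simple = λ _ → tt
    ; avoids-vertices = avoids-vertices
    ; avoids-edges = edges-meet }
    where
    avoids-vertices : ∀ {x y} → x — y → ∀ z → ¬ Interior x y (point z)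
    avoids-vertices {x} {y} xy z int@(_ , z≢x , z≢y) =
      decide (edges-meet xy (proj₂ (incident z)) (point z) int (start-on-segment (point z) _))
      where
      decide : ∀ {z′} → ¬ ((x ≡ z × y ≡ z′) ⊎ (x ≡ z′ × y ≡ z))
      decide (inj₁ (refl , _)) = z≢x refl
      decide (inj₂ (_ , refl)) = z≢y refl

odd-double : ∀ k → odd (2 * k) ≡ false
odd-double zero    = refl
odd-double (suc k) = trans (cong (not ∘ odd) (ℕ.+-suc k (k + 0)))
                           (trans (not-involutive (odd (2 * k))) (odd-double k))

-- Girth and exponent are abstracted so that both can be rewritten by a single `subst₂`.
Realised : (g r : ℕ) → Set₁
Realised g r = Σ[ B ∈ SignedBipartiteGraph ]
  let open SignedBipartiteGraph B in
  Planar graph ×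
  HasUnbalancedGirth signature g ×
  ((p : Bool) → HasCliqueOfSizeAtLeast (2 ^ r) (induced (signedPower B r) (λ v → part v ≡ p)))

theorem5 : (k : ℕ) → 2 ≤ k →
  Σ[ B ∈ SignedBipartiteGraph ]
    let open SignedBipartiteGraph B in
    Planar graph ×
    HasUnbalancedGirth signature (2 * k) ×
    ((p : Bool) →
      HasCliqueOfSizeAtLeast (2 ^ (2 * k ∸ 2))
        (induced (signedPower B (2 * k ∸ 2)) (λ v → part v ≡ p)))
theorem5 (suc zero) (s≤s ())
theorem5 (suc (suc k)) _ = subst₂ Realised girth≡ power≡ (B , drawing , girth , clique)
  where
  power≡ : suc (suc (2 * k)) ≡ 2 * suc (suc k) ∸ 2
  power≡ = lemma k
    where
    lemma : ∀ k → suc (suc (k + (k + 0))) ≡ k + suc (suc (k + 0))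
    lemma = ℕ-Solver.solve-∀
  girth≡ : suc (suc (2 * k)) + 2 ≡ 2 * suc (suc k)
  girth≡ = trans (ℕ.+-comm (suc (suc (2 * k))) 2) (cong (λ r → suc (suc r)) power≡)
  -- The theorem's parameter is k + 2 here, so the top gadget index `suc (suc (2 * k))` is twice
  -- that parameter minus 2.
  open Construction (suc (2 * k)) (trans (cong odd girth≡) (odd-double (suc (suc k))))
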